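{- For every integer $k\geq 3$ there exist a constant $c_k>0$ (depending only on $k$) and a sequence $(f_n)_{n\geq k}$, where each $f_n:\{0,1\}^{\binom{n}{k}}\rightarrow\{0,1\}$ is a non-constant $k$-uniform hypergraph property on $n$ vertices, such that $s(f_n)\leq c_k\, n^{\lceil k/3\rceil}$ for all $n\geq k$; that is, $s(f_n)=O(n^{\lceil k/3\rceil})$.
   Context: For a Boolean function $f:\{0,1\}^N\rightarrow\{0,1\}$ and an input $x\in\{0,1\}^N$, let $x^{\{i\}}$ denote $x$ with its $i$-th bit flipped. The sensitivity of $f$ on $x$ is $s(f,x)=|\{i : f(x)\neq f(x^{\{i\}})\}|$, and the sensitivity of $f$ is $s(f)=\max_x s(f,x)$. Index the variables of $f:\{0,1\}^{\binom{n}{k}}\rightarrow\{0,1\}$ by the $k$-element subsets $S$ of $[n]=\{1,\dots,n\}$ (so an input $x=(x_S)_S$ encodes a $k$-uniform hypergraph on vertex set $[n]$). The function $f$ is called a $k$-uniform hypergraph property if for every input $x=(x_S)_S$ and every permutation $\sigma\in S_n$, $f((x_S)_S)=f((x_{\sigma(S)})_S)$, where $\sigma(S)=\{\sigma(i) : i\in S\}$. -}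

module Defs where

open import Algebra.Properties.CommutativeMonoid.Sum using (sum-permute)
open import Data.Bool using (Bool; true; false; not; if_then_else_)
import Data.Bool.Properties as Bool
open import Data.Fin using (Fin; zero; suc)
open import Data.Fin.Permutation using (Permutation′; _⟨$⟩ˡ_; _⟨$⟩ʳ_; cast-id; flip; inverseˡ)
open import Data.Fin.Properties using (+↔⊎)
open import Data.Fin.Subset using (Subset; inside; outside; ∣_∣; _∈_) renaming (⊥ to ∅)
open import Data.Fin.Subset.Properties using (∣⊥∣≡0)
open import Data.List using (List; []; _∷_; map; cartesianProductWith)
open import Data.List.Extrema.Nat using (max)
open import Data.List.Membership.Propositional using () renaming (_∈_ to _∈ˡ_)
open import Data.List.Membership.Propositional.Properties using (∈-cartesianProductWith⁺)
open import Data.List.Relation.Unary.Any using (here; there)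
open import Data.Nat using (ℕ; zero; suc; _+_)
open import Data.Nat.Combinatorics using (_C_; nCk+nC[k+1]≡[n+1]C[k+1])
open import Data.Nat.DivMod using (_/_)
open import Data.Nat.Properties using (+-0-commutativeMonoid; ≡-irrelevant; suc-injective)
open import Data.Product using (∃-syntax; ∃₂; _,_)
open import Data.Sum using (_⊎_; inj₁; inj₂)
open import Data.Sum.Function.Propositional using (_⊎-↔_)
open import Data.Vec using (Vec; []; _∷_; lookup; tabulate; updateAt; count; allFin)
open import Data.Vec.Functional using () renaming (foldr to foldrᶠ)
open import Data.Vec.Properties using (lookup∘tabulate; []=⇒lookup; lookup⇒[]=; tabulate∘lookup)
open import Function using (_∘_; _↔_; _⇔_; mk↔ₛ′; mk⇔; Inverse)
open import Function.Construct.Composition using (_↔-∘_)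
open import Relation.Binary.PropositionalEquality
open import Relation.Nullary.Decidable using (¬?)

------------------------------------------------------------------------
-- Boolean functions and sensitivity

BooleanFunction : ℕ → Set
BooleanFunction N = Vec Bool N → Bool

flipBit : ∀ {N} → Vec Bool N → Fin N → Vec Bool N
flipBit x i = updateAt x i not

sensitivityAt : ∀ {N} → BooleanFunction N → Vec Bool N → ℕ
sensitivityAt {N} f x = count (λ i → ¬? (f x Bool.≟ f (flipBit x i))) (allFin N)

bits : List Bool
bits = false ∷ true ∷ []

cube : ∀ N → List (Vec Bool N)
cube zero    = [] ∷ []
cube (suc N) = cartesianProductWith _∷_ bits (cube N)

∈-cube : ∀ {N} (x : Vec Bool N) → x ∈ˡ cube N
∈-cube []      = here refl
∈-cube (b ∷ x) = ∈-cartesianProductWith⁺ _∷_ (∈-bits b) (∈-cube x)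
  where
  ∈-bits : ∀ b → b ∈ˡ bits
  ∈-bits false = here refl
  ∈-bits true  = there (here refl)

-- The default value 0 of max is harmless, as cube N is non-empty.
sensitivity : ∀ {N} → BooleanFunction N → ℕ
sensitivity {N} f = max 0 (map (sensitivityAt f) (cube N))

NonConstant : ∀ {N} → BooleanFunction N → Set
NonConstant f = ∃₂ λ x y → f x ≢ f y

------------------------------------------------------------------------
-- k-element subsets of Fin n

KSubset : ℕ → ℕ → Set
KSubset n k = ∃[ S ] ∣_∣ {n} S ≡ k

KSubset-≡ : ∀ {n k} {S T : Subset n} {p : ∣ S ∣ ≡ k} {q : ∣ T ∣ ≡ k} →
            S ≡ T → _≡_ {A = KSubset n k} (S , p) (T , q)
KSubset-≡ {S = S} refl = cong (S ,_) (≡-irrelevant _ _)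

∣S∣≡0⇒S≡∅ : ∀ {n} (S : Subset n) → ∣ S ∣ ≡ 0 → S ≡ ∅
∣S∣≡0⇒S≡∅ []            _ = refl
∣S∣≡0⇒S≡∅ (outside ∷ S) p = cong (outside ∷_) (∣S∣≡0⇒S≡∅ S p)

KSubset-split : ∀ n k → (KSubset n k ⊎ KSubset n (suc k)) ↔ KSubset (suc n) (suc k)
KSubset-split n k = mk↔ₛ′ to from to∘from from∘to
  where
  to : KSubset n k ⊎ KSubset n (suc k) → KSubset (suc n) (suc k)
  to (inj₁ (S , p)) = inside ∷ S , cong suc p
  to (inj₂ (S , p)) = outside ∷ S , p

  from : KSubset (suc n) (suc k) → KSubset n k ⊎ KSubset n (suc k)
  from (inside  ∷ S , p) = inj₁ (S , suc-injective p)
  from (outside ∷ S , p) = inj₂ (S , p)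

  to∘from : ∀ S → to (from S) ≡ S
  to∘from (inside  ∷ S , p) = KSubset-≡ refl
  to∘from (outside ∷ S , p) = refl

  from∘to : ∀ S → from (to S) ≡ S
  from∘to (inj₁ (S , p)) = cong inj₁ (KSubset-≡ refl)
  from∘to (inj₂ (S , p)) = refl

-- A fixed numbering of the k-element subsets, identifying {0,1}^(n C k)
-- with the families (x_S) indexed by k-element subsets S.
enumerate : ∀ n k → Fin (n C k) ↔ KSubset n k
enumerate n zero = mk↔ₛ′
  (λ _ → ∅ , ∣⊥∣≡0 n)
  (λ _ → zero)
  (λ (S , p) → KSubset-≡ (sym (∣S∣≡0⇒S≡∅ S p)))
  (λ { zero → refl })
enumerate zero (suc k) = mk↔ₛ′ (λ ()) (λ { ([] , ()) }) (λ { ([] , ()) }) (λ ())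
enumerate (suc n) (suc k) =
  KSubset-split n k ↔-∘ ((enumerate n k ⊎-↔ enumerate n (suc k)) ↔-∘ (+↔⊎ ↔-∘ pascal))
  where pascal = cast-id (sym (nCk+nC[k+1]≡[n+1]C[k+1] n k))

index : ∀ {n k} → KSubset n k → Fin (n C k)
index {n} {k} = Inverse.from (enumerate n k)

kSubset : ∀ {n k} → Fin (n C k) → KSubset n k
kSubset {n} {k} = Inverse.to (enumerate n k)

------------------------------------------------------------------------
-- The image σ(S) = {σ(i) : i ∈ S}

-- j ∈ σ(S) iff σ⁻¹(j) ∈ S.
image : ∀ {n} → Permutation′ n → Subset n → Subset n
image σ S = tabulate (λ j → lookup S (σ ⟨$⟩ˡ j))

∈-image : ∀ {n} (σ : Permutation′ n) (S : Subset n) i →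
          i ∈ S ⇔ (σ ⟨$⟩ʳ i) ∈ image σ S
∈-image σ S i = mk⇔
  (λ i∈S → lookup⇒[]= _ _ (trans lookup-image ([]=⇒lookup i∈S)))
  (λ σi∈σS → lookup⇒[]= i S (trans (sym lookup-image) ([]=⇒lookup σi∈σS)))
  where
  lookup-image : lookup (image σ S) (σ ⟨$⟩ʳ i) ≡ lookup S i
  lookup-image = trans (lookup∘tabulate _ (σ ⟨$⟩ʳ i)) (cong (lookup S) (inverseˡ σ))

∣image∣ : ∀ {n} (σ : Permutation′ n) (S : Subset n) → ∣ image σ S ∣ ≡ ∣ S ∣
∣image∣ σ S = begin
  ∣ image σ S ∣                                ≡⟨ ∣tabulate∣ (lookup S ∘ (σ ⟨$⟩ˡ_)) ⟩
  sumᶠ (indicator ∘ lookup S ∘ (σ ⟨$⟩ˡ_))      ≡⟨ sum-permute +-0-commutativeMonoid (indicator ∘ lookup S) (flip σ) ⟨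
  sumᶠ (indicator ∘ lookup S)                  ≡⟨ ∣tabulate∣ (lookup S) ⟨
  ∣ tabulate (lookup S) ∣                      ≡⟨ cong ∣_∣ (tabulate∘lookup S) ⟩
  ∣ S ∣                                        ∎
  where
  open ≡-Reasoning

  indicator : Bool → ℕ
  indicator b = if b then 1 else 0

  sumᶠ : ∀ {m} → (Fin m → ℕ) → ℕ
  sumᶠ = foldrᶠ _+_ 0

  ∣tabulate∣ : ∀ {m} (g : Fin m → Bool) → ∣ tabulate g ∣ ≡ sumᶠ (indicator ∘ g)
  ∣tabulate∣ {zero}  g = refl
  ∣tabulate∣ {suc m} g with g zero
  ... | true  = cong suc (∣tabulate∣ (g ∘ suc))
  ... | false = ∣tabulate∣ (g ∘ suc)

kImage : ∀ {n k} → Permutation′ n → KSubset n k → KSubset n k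
kImage σ (S , p) = image σ S , trans (∣image∣ σ S) p

------------------------------------------------------------------------
-- Hypergraph properties

-- relabel σ (x_S)_S = (x_σ(S))_S
relabel : ∀ {n k} → Permutation′ n → Vec Bool (n C k) → Vec Bool (n C k)
relabel {n} {k} σ x = tabulate (λ i → lookup x (index {n} {k} (kImage σ (kSubset i))))

IsHypergraphProperty : ∀ n k → BooleanFunction (n C k) → Set
IsHypergraphProperty n k f = ∀ (σ : Permutation′ n) x → f x ≡ f (relabel {n} {k} σ x)

⌈_/3⌉ : ℕ → ℕ
⌈ k /3⌉ = (k + 2) / 3

{-# OPTIONS --safe #-}
module Submission where

-- Write k = L + q with q = ⌈k/3⌉. Let f x = 1 iff there are vertex sets Z ⊆ A of fixed
-- sizes such that every edge d with |d ∩ A| = L has x_d = |d ∩ Z| mod 2 and every edge d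
-- with |d ∩ A| = L + 1 has x_d = 1. A pattern constrains only edges with at most q vertices
-- outside A, so O(n^q) bits are sensitive at a 1-input. At a 0-input each sensitive bit
-- completes some pattern (A , Z). Two different patterns whose vertex sets share
-- c = 2L − k ≤ q vertices disagree on an edge other than the two flipped ones, so sending a
-- sensitive bit to a q-subset of its A is injective, and at most n^q bits are sensitive.
--
-- For the disagreement let A ≠ B and look at A ∖ Z. If it has many vertices in B, an edge
-- with L of them and one vertex of B ∖ A must be 0 for (A , Z) and 1 for (B , Y).
-- Otherwise both A ∖ Z ∖ B and B ∖ A are large. If some a ∈ Z lies outside B, exchanging it
-- with a vertex of A ∖ Z ∖ B in an edge with L vertices in A and in B flips the value
-- required by (A , Z) only. If Z ⊆ B, an edge with an even number of vertices in Z and L,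
-- respectively L + 1, vertices in A and B must be 0 for (A , Z) and 1 for (B , Y).
-- If A = B and Z ≠ Y, exchange a vertex of Z ∖ Y with one of A ∖ Z ∖ Y.

open import Defs
open import Data.Bool using (Bool; true; false; not; _∧_)
import Data.Bool.Properties as Bool
open import Data.Fin using (Fin; zero; suc; combine; funToFin; finToFun)
import Data.Fin as Fin
open import Data.Fin.Permutation using (Permutation′; _⟨$⟩ˡ_; _⟨$⟩ʳ_; flip; inverseʳ)
open import Data.Fin.Properties using (suc-injective; injective⇒≤; combine-injective; finToFun-funToFin; all?)
open import Data.Fin.Subset renaming (⊥ to ∅; ⊤ to full)
open import Data.Fin.Subset.Properties
open import Data.List using (List; []; _∷_)
open import Data.List.Extrema.Nat using (max≤v⁺)
open import Data.List.Relation.Unary.All as All using (All; []; _∷_)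
import Data.List.Relation.Unary.All.Properties as All
open import Data.List.Relation.Unary.AllPairs using (AllPairs; []; _∷_)
open import Data.Nat using (ℕ; zero; suc; _+_; _*_; _^_; _≤_; _<_; z≤n; s≤s; s≤s⁻¹; _≤?_; >-nonZero)
import Data.Nat as ℕ
open import Data.Nat.Combinatorics using (_C_; nCk+nC[k+1]≡[n+1]C[k+1]; k>n⇒nCk≡0)
open import Data.Nat.Divisibility using (∣-refl)
open import Data.Nat.DivMod using (+-distrib-/-∣ˡ)
open import Data.Nat.Properties hiding (suc-injective)
open import Data.Product using (Σ-syntax; ∃-syntax; _×_; _,_; proj₁; proj₂; uncurry)
open import Data.Sum using (inj₁; inj₂; [_,_]′)
open import Data.Vec using (Vec; []; _∷_; here; there; lookup; tabulate; count; allFin; replicate)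
open import Data.Vec.Properties using (≡-dec; lookup∘tabulate; tabulate∘lookup; tabulate-cong;
  lookup-zipWith; []=⇒lookup; lookup⇒[]=; lookup∘updateAt′; lookup-replicate; count≤n)
open import Function using (_∘_; mk⇔; Injective; Inverse)
open import Relation.Binary.PropositionalEquality
open import Relation.Nullary using (¬_; Dec; yes; no; does; contradiction)
open import Relation.Nullary.Decidable using (decidable-stable; does-⇔; map′; _×-dec_; _→-dec_; ¬?;
  dec-true; dec-false)
open import Relation.Unary using (Pred; Decidable)

-- Cardinalities of subsets

Disjoint : ∀ {n} → Subset n → Subset n → Set
Disjoint K D = ∀ {y} → y ∈ K → y ∉ D

private
  variable
    n a b : ℕ
    K D S T X : Subset n

∣∣-split : (S X : Subset n) → ∣ S ∣ ≡ ∣ S ∩ X ∣ + ∣ S ∩ ∁ X ∣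
∣∣-split []          []          = refl
∣∣-split (true  ∷ S) (true  ∷ X) = cong suc (∣∣-split S X)
∣∣-split (true  ∷ S) (false ∷ X) =
  trans (cong suc (∣∣-split S X)) (sym (+-suc ∣ S ∩ X ∣ ∣ S ∩ ∁ X ∣))
∣∣-split (false ∷ S) (x     ∷ X) = ∣∣-split S X

∩-∪-card : (K D X : Subset n) → Disjoint K D →
           ∣ (K ∪ D) ∩ X ∣ ≡ ∣ K ∩ X ∣ + ∣ D ∩ X ∣
∩-∪-card [] [] [] _ = refl
∩-∪-card (true ∷ K) (true ∷ D) (x ∷ X) dis = contradiction here (dis here)
∩-∪-card (true ∷ K) (false ∷ D) (true ∷ X) dis =
  cong suc (∩-∪-card K D X (λ p q → dis (there p) (there q)))
∩-∪-card (true ∷ K) (false ∷ D) (false ∷ X) dis =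
  ∩-∪-card K D X (λ p q → dis (there p) (there q))
∩-∪-card (false ∷ K) (true ∷ D) (true ∷ X) dis =
  trans (cong suc (∩-∪-card K D X (λ p q → dis (there p) (there q))))
        (sym (+-suc ∣ K ∩ X ∣ ∣ D ∩ X ∣))
∩-∪-card (false ∷ K) (true ∷ D) (false ∷ X) dis =
  ∩-∪-card K D X (λ p q → dis (there p) (there q))
∩-∪-card (false ∷ K) (false ∷ D) (x ∷ X) dis =
  ∩-∪-card K D X (λ p q → dis (there p) (there q))

∩-card-⊆ : (K X : Subset n) → K ⊆ X → ∣ K ∩ X ∣ ≡ ∣ K ∣
∩-card-⊆ K X K⊆X =
  cong ∣_∣ (⊆-antisym (p∩q⊆p K X) (λ y∈K → x∈p∩q⁺ (y∈K , K⊆X y∈K)))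

∩-card-disjoint : (K X : Subset n) → Disjoint K X → ∣ K ∩ X ∣ ≡ 0
∩-card-disjoint {n} K X dis =
  trans (cong ∣_∣ (Empty-unique λ (y , y∈) → uncurry dis (x∈p∩q⁻ K X y∈))) (∣⊥∣≡0 n)

-- Edges are built as unions of disjoint pieces, and a derivation of `Meets` records for each piece
-- whether it lies inside `X`, misses `X`, or meets it in an unevaluated number (`any`). `meets`
-- then reads off every intersection size; with `X = full` this is the size of the edge itself.
data Meets (X : Subset n) : List (Subset n) → ℕ → Set where
  []  : Meets X [] 0
  sub : ∀ {K Ks a b} → K ⊆ X → ∣ K ∣ ≡ a → Meets X Ks b → Meets X (K ∷ Ks) (a + b)
  dis : ∀ {K Ks b} → Disjoint K X → Meets X Ks b → Meets X (K ∷ Ks) b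
  any : ∀ {K Ks b} → Meets X Ks b → Meets X (K ∷ Ks) (∣ K ∩ X ∣ + b)

⋃-disjoint : ∀ {Ks} → All (Disjoint X) Ks → Disjoint X (⋃ Ks)
⋃-disjoint [] y∈X = ∉⊥
⋃-disjoint {Ks = K ∷ Ks} (d ∷ ds) y∈X y∈ =
  [ d y∈X , ⋃-disjoint ds y∈X ]′ (x∈p∪q⁻ K (⋃ Ks) y∈)

disjoint-⊆ : ∀ {Ks} → Disjoint X T → All (_⊆ T) Ks → All (Disjoint X) Ks
disjoint-⊆ X∥T []           = []
disjoint-⊆ X∥T (K⊆T ∷ Ks⊆T) = (λ y∈X y∈K → X∥T y∈X (K⊆T y∈K)) ∷ disjoint-⊆ X∥T Ks⊆T

meets : ∀ {Ks} → AllPairs Disjoint Ks → Meets X Ks a → ∣ ⋃ Ks ∩ X ∣ ≡ a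
meets {X = X} [] [] = ∩-card-disjoint ∅ X (λ y∈ → contradiction y∈ ∉⊥)
meets {X = X} {Ks = K ∷ Ks} (d ∷ ds) (sub K⊆X p m) = trans
  (∩-∪-card K (⋃ Ks) X (⋃-disjoint d))
  (cong₂ _+_ (trans (∩-card-⊆ K X K⊆X) p) (meets ds m))
meets {X = X} {Ks = K ∷ Ks} (d ∷ ds) (dis K∉X m) = trans
  (∩-∪-card K (⋃ Ks) X (⋃-disjoint d))
  (cong₂ _+_ (∩-card-disjoint K X K∉X) (meets ds m))
meets {X = X} {Ks = K ∷ Ks} (d ∷ ds) (any m) = trans
  (∩-∪-card K (⋃ Ks) X (⋃-disjoint d))
  (cong (∣ K ∩ X ∣ +_) (meets ds m))

meets-any : ∀ X (Ks : List (Subset n)) → ∃[ a ] Meets X Ks a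
meets-any X []       = 0 , []
meets-any X (K ∷ Ks) = _ , any (proj₂ (meets-any X Ks))

∣⋃∣ : ∀ {Ks : List (Subset n)} → AllPairs Disjoint Ks → Meets full Ks a → ∣ ⋃ Ks ∣ ≡ a
∣⋃∣ {Ks = Ks} ds m = trans (sym (∩-card-⊆ (⋃ Ks) full ⊆⊤)) (meets ds m)

⁅⁆-⊆ : ∀ {y : Fin n} → y ∈ X → ⁅ y ⁆ ⊆ X
⁅⁆-⊆ {X = X} {y} y∈X z∈ = subst (_∈ X) (sym (x∈⁅y⁆⇒x≡y y z∈)) y∈X

⁅⁆-disjoint : ∀ {y : Fin n} → y ∉ X → Disjoint ⁅ y ⁆ X
⁅⁆-disjoint {X = X} {y} y∉X z∈ = subst (_∉ X) (sym (x∈⁅y⁆⇒x≡y y z∈)) y∉X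

⁅⁆-disjoints : ∀ {y : Fin n} {Ks} → All (y ∉_) Ks → All (Disjoint ⁅ y ⁆) Ks
⁅⁆-disjoints []             = []
⁅⁆-disjoints (y∉K ∷ y∉Ks) = ⁅⁆-disjoint y∉K ∷ ⁅⁆-disjoints y∉Ks

disjoint-⁅⁆ : ∀ {y : Fin n} → y ∉ X → Disjoint X ⁅ y ⁆
disjoint-⁅⁆ y∉X z∈X z∈ = ⁅⁆-disjoint y∉X z∈ z∈X

∈∩∁⇒∉ : (S T : Subset n) → ∀ {y} → y ∈ S ∩ ∁ T → y ∉ T
∈∩∁⇒∉ S T y∈ = x∈∁p⇒x∉p (p∩q⊆q S (∁ T) y∈)

choose : (S : Subset n) → ∀ {a} → a ≤ ∣ S ∣ → ∃[ K ] K ⊆ S × ∣ K ∣ ≡ a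
choose {n} S {zero} _ = ∅ , (λ y∈ → contradiction y∈ ∉⊥) , ∣⊥∣≡0 n
choose (false ∷ S) {suc a} a≤ with choose S a≤
... | K , K⊆S , p = false ∷ K , s⊆s K⊆S , p
choose (true ∷ S) {suc a} (s≤s a≤) with choose S a≤
... | K , K⊆S , p = true ∷ K , s⊆s K⊆S , cong suc p

element : (S : Subset n) → 1 ≤ ∣ S ∣ → Nonempty S
element (true  ∷ S) _ = zero , here
element (false ∷ S) p with element S p
... | y , y∈S = suc y , there y∈S

element-suc : (S : Subset n) → ∣ S ∣ ≡ suc a → Nonempty S
element-suc S p = element S (subst (1 ≤_) (sym p) (s≤s z≤n))

∩∁≡0⇒⊆ : (S T : Subset n) → ∣ S ∩ ∁ T ∣ ≡ 0 → S ⊆ T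
∩∁≡0⇒⊆ S T p {y} y∈S with y ∈? T
... | yes y∈T = y∈T
... | no  y∉T =
  contradiction (subst (y ∈_) (∣S∣≡0⇒S≡∅ (S ∩ ∁ T) p) (x∈p∩q⁺ (y∈S , x∉p⇒x∈∁p y∉T))) ∉⊥

∩-card-comm : (S T : Subset n) → ∣ S ∩ T ∣ ≡ ∣ T ∩ S ∣
∩-card-comm S T = cong ∣_∣ (∩-comm S T)

∩∁-card-comm : (S T : Subset n) → ∣ S ∣ ≡ ∣ T ∣ → ∣ S ∩ ∁ T ∣ ≡ ∣ T ∩ ∁ S ∣
∩∁-card-comm S T p = +-cancelˡ-≡ ∣ S ∩ T ∣ _ _ (begin
  ∣ S ∩ T ∣ + ∣ S ∩ ∁ T ∣   ≡⟨ ∣∣-split S T ⟨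
  ∣ S ∣                     ≡⟨ p ⟩
  ∣ T ∣                     ≡⟨ ∣∣-split T S ⟩
  ∣ T ∩ S ∣ + ∣ T ∩ ∁ S ∣   ≡⟨ cong (_+ ∣ T ∩ ∁ S ∣) (∩-card-comm T S) ⟩
  ∣ S ∩ T ∣ + ∣ T ∩ ∁ S ∣   ∎)
  where open ≡-Reasoning

∖-nonempty : (S T : Subset n) → ∣ S ∣ ≡ ∣ T ∣ → S ≢ T → Nonempty (S ∩ ∁ T)
∖-nonempty S T p S≢T with ∣ S ∩ ∁ T ∣ in eq
... | suc _ = element-suc (S ∩ ∁ T) eq
... | zero  = contradiction (⊆-antisym (∩∁≡0⇒⊆ S T eq) (∩∁≡0⇒⊆ T S (trans (sym (∩∁-card-comm S T p)) eq))) S≢T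

∩∁-card-≥ : (S T : Subset n) → a + b ≤ ∣ S ∣ → ∣ S ∩ T ∣ ≤ a → b ≤ ∣ S ∩ ∁ T ∣
∩∁-card-≥ {a = a} {b} S T p q = +-cancelˡ-≤ a _ _ (begin
  a + b                     ≤⟨ p ⟩
  ∣ S ∣                     ≡⟨ ∣∣-split S T ⟩
  ∣ S ∩ T ∣ + ∣ S ∩ ∁ T ∣   ≤⟨ +-monoˡ-≤ ∣ S ∩ ∁ T ∣ q ⟩
  a + ∣ S ∩ ∁ T ∣           ∎)
  where open ≤-Reasoning

-- Q is P without one element of e ∩ P, if there is any.
avoid₁ : (P e : Subset n) → ∃[ Q ] Q ⊆ P × ∣ P ∣ ≤ suc ∣ Q ∣ ×
         (∀ {K D} → Nonempty K → K ⊆ Q → Disjoint P D → K ∪ D ≢ e)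
avoid₁ {n} P e with nonempty? (e ∩ P)
... | no  ∄ = P , (λ y∈ → y∈) , m≤n+m ∣ P ∣ 1 ,
  λ {K} {D} (y , y∈K) K⊆P _ K∪D≡e →
    ∄ (y , x∈p∩q⁺ (subst (y ∈_) K∪D≡e (x∈p∪q⁺ (inj₁ y∈K)) , K⊆P y∈K))
... | yes (u , u∈) = P ∩ ∁ ⁅ u ⁆ , p∩q⊆p P (∁ ⁅ u ⁆) ,
  subst (_≤ suc ∣ P ∩ ∁ ⁅ u ⁆ ∣) (sym (∣∣-split P ⁅ u ⁆))
    (+-monoˡ-≤ ∣ P ∩ ∁ ⁅ u ⁆ ∣ (subst (∣ P ∩ ⁅ u ⁆ ∣ ≤_) (∣⁅x⁆∣≡1 u) (∣p∩q∣≤∣q∣ P ⁅ u ⁆))) ,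
  λ {K} {D} _ K⊆ dis K∪D≡e →
    [ (λ u∈K → ∈∩∁⇒∉ P ⁅ u ⁆ (K⊆ u∈K) (x∈⁅x⁆ u)) , (λ u∈D → dis (p∩q⊆q e P u∈) u∈D) ]′
      (x∈p∪q⁻ K D (subst (u ∈_) (sym K∪D≡e) (p∩q⊆p e P u∈)))

-- Supplies edges different from both flipped ones. A set `K ∪ D` of this form meets `P` exactly in
-- `K`: if `e` misses `P`, nonemptiness of `K` separates them, and otherwise `e` contains a vertex
-- of `P` that was removed. The price is one vertex of the pool for each of `e` and `e′`.
avoid₂ : (P e e′ : Subset n) → ∃[ Q ] Q ⊆ P × ∣ P ∣ ≤ suc (suc ∣ Q ∣) ×
         (∀ {K D} → Nonempty K → K ⊆ Q → Disjoint P D → K ∪ D ≢ e × K ∪ D ≢ e′)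
avoid₂ P e e′ with avoid₁ P e
... | P₁ , P₁⊆P , ∣P∣≤ , avoids with avoid₁ P₁ e′
...   | Q , Q⊆P₁ , ∣P₁∣≤ , avoids′ =
  Q , P₁⊆P ∘ Q⊆P₁ , ≤-trans ∣P∣≤ (s≤s ∣P₁∣≤) ,
  λ ne K⊆Q dis → avoids ne (Q⊆P₁ ∘ K⊆Q) dis , avoids′ ne K⊆Q (dis ∘ P₁⊆P)

-- Counting and encoding sensitive bits

nth : ∀ {n} (S : Subset n) → Fin ∣ S ∣ → Fin n
nth (true  ∷ S) zero    = zero
nth (true  ∷ S) (suc i) = suc (nth S i)
nth (false ∷ S) i       = suc (nth S i)

nth-∈ : ∀ {n} (S : Subset n) i → nth S i ∈ S
nth-∈ (true  ∷ S) zero    = here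
nth-∈ (true  ∷ S) (suc i) = there (nth-∈ S i)
nth-∈ (false ∷ S) i       = there (nth-∈ S i)

nth-injective : ∀ {n} (S : Subset n) → Injective _≡_ _≡_ (nth S)
nth-injective (true  ∷ S) {zero}  {zero}  _  = refl
nth-injective (true  ∷ S) {suc i} {suc j} eq = cong suc (nth-injective S (suc-injective eq))
nth-injective (false ∷ S)                 eq = nth-injective S (suc-injective eq)

nth-surjective : ∀ {n} (S : Subset n) {y} → y ∈ S → ∃[ i ] nth S i ≡ y
nth-surjective (true ∷ S) here = zero , refl
nth-surjective (true ∷ S) (there y∈S) with nth-surjective S y∈S
... | i , eq = suc i , cong suc eq
nth-surjective (false ∷ S) (there y∈S) with nth-surjective S y∈S
... | i , eq = i , cong suc eq

count-tabulate : ∀ {a p} {A : Set a} {P : Pred A p} (P? : Decidable P) {n} (h : Fin n → A) →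
                 count P? (tabulate h) ≡ ∣ tabulate (does ∘ P? ∘ h) ∣
count-tabulate P? {zero}  h = refl
count-tabulate P? {suc n} h with does (P? (h zero))
... | true  = cong suc (count-tabulate P? (h ∘ suc))
... | false = count-tabulate P? (h ∘ suc)

does-true : ∀ {p} {P : Set p} (P? : Dec P) → does P? ≡ true → P
does-true (yes p) _ = p

-- The code may depend on the proof of `P i`, since a sensitive bit is encoded through a pattern
-- that its sensitivity provides. Listing the satisfying indices by `nth` fixes one proof for each
-- and gives an injection into `Fin M`.
count-≤ : ∀ {p n M} {P : Pred (Fin n) p} (P? : Decidable P) (code : ∀ i → P i → Fin M) →
          (∀ i j p q → code i p ≡ code j q → i ≡ j) → count P? (allFin n) ≤ M
count-≤ {n = n} {M} {P} P? code code-injective =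
  subst (_≤ M) (sym (count-tabulate P? (λ i → i))) (injective⇒≤ {f = λ i → code (nth sat i) (holds i)}
    (λ eq → nth-injective sat (code-injective _ _ _ _ eq)))
  where
  sat : Subset n
  sat = tabulate (does ∘ P?)

  holds : ∀ i → P (nth sat i)
  holds i = does-true (P? (nth sat i))
    (trans (sym (lookup∘tabulate (does ∘ P?) (nth sat i))) ([]=⇒lookup (nth-∈ sat i)))

sensitivity-≤ : ∀ {N} (f : BooleanFunction N) {M} → (∀ x → sensitivityAt f x ≤ M) → sensitivity f ≤ M
sensitivity-≤ {N} f bound = max≤v⁺ z≤n (All.map⁺ (All.universal bound (cube N)))

nCk≤n^k : ∀ n k → n C k ≤ n ^ k
nCk≤n^k n zero = ≤-refl
nCk≤n^k zero (suc k) = ≤-reflexive (k>n⇒nCk≡0 {0} {suc k} (s≤s z≤n))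
nCk≤n^k (suc n) (suc k) = begin
  suc n C suc k             ≡⟨ nCk+nC[k+1]≡[n+1]C[k+1] n k ⟨
  n C k + n C suc k         ≤⟨ +-mono-≤ (nCk≤n^k n k) (nCk≤n^k n (suc k)) ⟩
  n ^ k + n * n ^ k         ≤⟨ *-monoʳ-≤ (suc n) (^-monoˡ-≤ k (n≤1+n n)) ⟩
  suc n * suc n ^ k         ∎
  where open ≤-Reasoning

index-injective : ∀ {n k} {d d′ : KSubset n k} → index d ≡ index d′ → d ≡ d′
index-injective {n} {k} {d} {d′} eq = begin
  d                          ≡⟨ Inverse.strictlyInverseˡ (enumerate n k) d ⟨
  kSubset {n} {k} (index d)  ≡⟨ cong kSubset eq ⟩
  kSubset {n} {k} (index d′) ≡⟨ Inverse.strictlyInverseˡ (enumerate n k) d′ ⟩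
  d′                         ∎
  where open ≡-Reasoning

kSubset-injective : ∀ {n k} {i j : Fin (n C k)} → kSubset {n} {k} i ≡ kSubset j → i ≡ j
kSubset-injective {n} {k} {i} {j} eq = begin
  i                          ≡⟨ Inverse.strictlyInverseʳ (enumerate n k) i ⟨
  index (kSubset {n} {k} i)  ≡⟨ cong index eq ⟩
  index (kSubset {n} {k} j)  ≡⟨ Inverse.strictlyInverseʳ (enumerate n k) j ⟩
  j                          ∎
  where open ≡-Reasoning

-- Images under permutations and invariance under relabelling

lookup-image : ∀ {n} (σ : Permutation′ n) S j → lookup (image σ S) j ≡ lookup S (σ ⟨$⟩ˡ j)
lookup-image σ S = lookup∘tabulate (λ j → lookup S (σ ⟨$⟩ˡ j))

lookup-ext : ∀ {n} {A : Set} {x y : Vec A n} → (∀ i → lookup x i ≡ lookup y i) → x ≡ y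
lookup-ext {x = x} {y} eq = begin
  x                    ≡⟨ tabulate∘lookup x ⟨
  tabulate (lookup x)  ≡⟨ tabulate-cong eq ⟩
  tabulate (lookup y)  ≡⟨ tabulate∘lookup y ⟩
  y                    ∎
  where open ≡-Reasoning

image-flip : ∀ {n} (σ : Permutation′ n) S → image σ (image (flip σ) S) ≡ S
image-flip σ S = lookup-ext λ j → begin
  lookup (image σ (image (flip σ) S)) j   ≡⟨ lookup-image σ (image (flip σ) S) j ⟩
  lookup (image (flip σ) S) (σ ⟨$⟩ˡ j)    ≡⟨ lookup-image (flip σ) S (σ ⟨$⟩ˡ j) ⟩
  lookup S (σ ⟨$⟩ʳ (σ ⟨$⟩ˡ j))            ≡⟨ cong (lookup S) (inverseʳ σ) ⟩
  lookup S j                              ∎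
  where open ≡-Reasoning

image-∩ : ∀ {n} (σ : Permutation′ n) S T → image σ (S ∩ T) ≡ image σ S ∩ image σ T
image-∩ σ S T = lookup-ext λ j → begin
  lookup (image σ (S ∩ T)) j                                    ≡⟨ lookup-image σ (S ∩ T) j ⟩
  lookup (S ∩ T) (σ ⟨$⟩ˡ j)                                     ≡⟨ lookup-zipWith _∧_ (σ ⟨$⟩ˡ j) S T ⟩
  lookup S (σ ⟨$⟩ˡ j) ∧ lookup T (σ ⟨$⟩ˡ j)           ≡⟨ cong₂ _∧_ (lookup-image σ S j) (lookup-image σ T j) ⟨
  lookup (image σ S) j ∧ lookup (image σ T) j         ≡⟨ lookup-zipWith _∧_ j (image σ S) (image σ T) ⟨
  lookup (image σ S ∩ image σ T) j                              ∎
  where open ≡-Reasoning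

image-mono : ∀ {n} (σ : Permutation′ n) {S T} → S ⊆ T → image σ S ⊆ image σ T
image-mono σ {S} {T} S⊆T {j} j∈ = lookup⇒[]= j (image σ T) (trans (lookup-image σ T j) ([]=⇒lookup (S⊆T
  (lookup⇒[]= (σ ⟨$⟩ˡ j) S (trans (sym (lookup-image σ S j)) ([]=⇒lookup j∈))))))

∣image∩∣ : ∀ {n} (σ : Permutation′ n) d S → ∣ image σ d ∩ S ∣ ≡ ∣ d ∩ image (flip σ) S ∣
∣image∩∣ σ d S = begin
  ∣ image σ d ∩ S ∣                            ≡⟨ cong (λ T → ∣ image σ d ∩ T ∣) (image-flip σ S) ⟨
  ∣ image σ d ∩ image σ (image (flip σ) S) ∣   ≡⟨ cong ∣_∣ (image-∩ σ d (image (flip σ) S)) ⟨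
  ∣ image σ (d ∩ image (flip σ) S) ∣           ≡⟨ ∣image∣ σ (d ∩ image (flip σ) S) ⟩
  ∣ d ∩ image (flip σ) S ∣                     ∎
  where open ≡-Reasoning

module _ {n k : ℕ} where

  lookup-relabel : ∀ σ (x : Vec Bool (n C k)) i →
                   lookup (relabel {n} {k} σ x) i ≡ lookup x (index {n} {k} (kImage σ (kSubset i)))
  lookup-relabel σ x = lookup∘tabulate (λ i → lookup x (index {n} {k} (kImage σ (kSubset i))))

  relabel-flip : ∀ σ (x : Vec Bool (n C k)) → relabel {n} {k} (flip σ) (relabel {n} {k} σ x) ≡ x
  relabel-flip σ x = lookup-ext λ i → begin
    lookup (relabel {n} {k} (flip σ) (relabel {n} {k} σ x)) i
      ≡⟨ lookup-relabel (flip σ) (relabel {n} {k} σ x) i ⟩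
    lookup (relabel {n} {k} σ x) (index {n} {k} (kImage (flip σ) (kSubset i)))
      ≡⟨ lookup-relabel σ x _ ⟩
    lookup x (index {n} {k} (kImage σ (kSubset (index {n} {k} (kImage (flip σ) (kSubset i))))))
      ≡⟨ cong (λ d → lookup x (index {n} {k} (kImage σ d)))
              (Inverse.strictlyInverseˡ (enumerate n k) (kImage (flip σ) (kSubset i))) ⟩
    lookup x (index {n} {k} (kImage σ (kImage (flip σ) (kSubset i))))
      ≡⟨ cong (λ d → lookup x (index {n} {k} d)) (KSubset-≡ (image-flip σ (proj₁ (kSubset {n} {k} i)))) ⟩
    lookup x (index {n} {k} (kSubset i))
      ≡⟨ cong (lookup x) (Inverse.strictlyInverseʳ (enumerate n k) i) ⟩
    lookup x i  ∎
    where open ≡-Reasoning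

  -- Closure in one direction suffices: applied to the inverse permutation it gives the converse,
  -- because `flip σ` undoes the relabelling.
  relabel-closed⇒property : ∀ {p} {P : Pred (Vec Bool (n C k)) p} (P? : Decidable P) →
    (∀ σ x → P x → P (relabel {n} {k} σ x)) → IsHypergraphProperty n k (does ∘ P?)
  relabel-closed⇒property {P = P} P? closed σ x = does-⇔ (mk⇔ (closed σ x)
    (λ Px → subst P (relabel-flip σ x) (closed (flip σ) (relabel {n} {k} σ x) Px)))
    (P? x) (P? (relabel {n} {k} σ x))

-- Coding an edge by its trace on a vertex set and a small remainder

bit : Bool → Fin 2
bit false = zero
bit true  = suc zero

bit-injective : ∀ {a b} → bit a ≡ bit b → a ≡ b
bit-injective {false} {false} _ = refl
bit-injective {true}  {true}  _ = refl

-- The set `d ∩ A` as a number. Its range depends on the size of `A` only, so for vertex sets of the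
-- fixed size `m` it contributes a constant factor.
trace : ∀ {n} (A : Subset n) → Subset n → Fin (2 ^ ∣ A ∣)
trace A d = funToFin (λ i → bit (lookup d (nth A i)))

trace-lookup : ∀ {n} (A : Subset n) {d d′ y} → trace A d ≡ trace A d′ → y ∈ A → lookup d y ≡ lookup d′ y
trace-lookup A {d} {d′} eq y∈A with i , refl ← nth-surjective A y∈A = bit-injective (begin
  bit (lookup d (nth A i))     ≡⟨ finToFun-funToFin (λ i → bit (lookup d (nth A i))) i ⟨
  finToFun (trace A d) i       ≡⟨ cong (λ t → finToFun t i) eq ⟩
  finToFun (trace A d′) i      ≡⟨ finToFun-funToFin (λ i → bit (lookup d′ (nth A i))) i ⟩
  bit (lookup d′ (nth A i))    ∎)
  where open ≡-Reasoning

-- A k-set d with at least L elements in A is determined by d ∩ A together with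
-- the k − L elements left after removing L elements of A from it.
module _ {n} (A : Subset n) {L q : ℕ} where

  remainder : (d : KSubset n (L + q)) → L ≤ ∣ proj₁ d ∩ A ∣ →
              Σ[ R ∈ KSubset n q ] proj₁ R ⊆ proj₁ d × (∀ {y} → y ∈ proj₁ d → y ∉ A → y ∈ proj₁ R)
  remainder (d , ∣d∣) L≤ with K , K⊆ , ∣K∣ ← choose (d ∩ A) L≤ =
    (d ∩ ∁ K , ∣R∣) , p∩q⊆p d (∁ K) ,
    λ y∈d y∉A → x∈p∩q⁺ (y∈d , x∉p⇒x∈∁p (λ y∈K → y∉A (p∩q⊆q d A (K⊆ y∈K))))
    where
    ∣R∣ : ∣ d ∩ ∁ K ∣ ≡ q
    ∣R∣ = +-cancelˡ-≡ L _ _ (begin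
      L + ∣ d ∩ ∁ K ∣            ≡⟨ cong (_+ ∣ d ∩ ∁ K ∣) ∣K∣ ⟨
      ∣ K ∣ + ∣ d ∩ ∁ K ∣        ≡⟨ cong (_+ ∣ d ∩ ∁ K ∣) (∩-card-⊆ K d (λ y∈K → p∩q⊆p d A (K⊆ y∈K))) ⟨
      ∣ K ∩ d ∣ + ∣ d ∩ ∁ K ∣    ≡⟨ cong (_+ ∣ d ∩ ∁ K ∣) (∩-card-comm K d) ⟩
      ∣ d ∩ K ∣ + ∣ d ∩ ∁ K ∣    ≡⟨ ∣∣-split d K ⟨
      ∣ d ∣                      ≡⟨ ∣d∣ ⟩
      L + q                      ∎)
      where open ≡-Reasoning

  code : (d : KSubset n (L + q)) → L ≤ ∣ proj₁ d ∩ A ∣ → Fin (2 ^ ∣ A ∣ * (n C q))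
  code d L≤ = combine (trace A (proj₁ d)) (index {n} {q} (proj₁ (remainder d L≤)))

  code-⊆ : ∀ d d′ L≤ L≤′ → code d L≤ ≡ code d′ L≤′ → proj₁ d ⊆ proj₁ d′
  code-⊆ d d′ L≤ L≤′ eq {y} y∈d
    with combine-injective (trace A (proj₁ d)) (index {n} {q} (proj₁ (remainder d L≤)))
                           (trace A (proj₁ d′)) (index {n} {q} (proj₁ (remainder d′ L≤′))) eq
       | y ∈? A
  ... | same-trace , _ | yes y∈A =
    lookup⇒[]= y (proj₁ d′)
      (trans (sym (trace-lookup A {proj₁ d} {proj₁ d′} same-trace y∈A)) ([]=⇒lookup y∈d))
  ... | _ , same-index | no y∉A = proj₁ (proj₂ (remainder d′ L≤′))
    (subst (λ R → y ∈ proj₁ R) (index-injective {n} {q} same-index) (proj₂ (proj₂ (remainder d L≤)) y∈d y∉A))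

  code-injective : ∀ d d′ L≤ L≤′ → code d L≤ ≡ code d′ L≤′ → d ≡ d′
  code-injective d d′ L≤ L≤′ eq =
    KSubset-≡ (⊆-antisym (code-⊆ d d′ L≤ L≤′ eq) (code-⊆ d′ d L≤′ L≤ (sym eq)))

-- The pattern property

-- For the finitely many n below the threshold any property does, here the complete hypergraph.
module _ {n k : ℕ} where

  IsComplete : Vec Bool (n C k) → Set
  IsComplete x = ∀ i → lookup x i ≡ true

  isComplete? : ∀ x → Dec (IsComplete x)
  isComplete? x = all? λ i → lookup x i Bool.≟ true

  complete : BooleanFunction (n C k)
  complete x = does (isComplete? x)

  complete-property : IsHypergraphProperty n k complete
  complete-property = relabel-closed⇒property {n} {k} isComplete?
    (λ σ x all i → trans (lookup-relabel {n} {k} σ x i) (all (index {n} {k} (kImage σ (kSubset {n} {k} i)))))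

  complete-nonConstant : k ≤ n → NonConstant complete
  complete-nonConstant k≤n with S , _ , ∣S∣ ← choose (full {n}) {k} (subst (k ≤_) (sym (∣⊤∣≡n n)) k≤n) =
    replicate (n C k) true , replicate (n C k) false , λ eq → contradiction
      (trans (sym (dec-true (isComplete? (replicate (n C k) true)) (λ i → lookup-replicate i true)))
        (trans eq (dec-false (isComplete? (replicate (n C k) false)) λ all → contradiction
          (trans (sym (lookup-replicate (edge S ∣S∣) false)) (all (edge S ∣S∣))) (λ ()))))
      (λ ())
    where
    edge : (S : Subset n) → ∣ S ∣ ≡ k → Fin (n C k)
    edge S ∣S∣ = index {n} {k} (S , ∣S∣)

-- One constant that dominates the number of edges for every `n` below `t` at once.
∑C : ℕ → ℕ → ℕ
∑C k zero    = 0
∑C k (suc t) = t C k + ∑C k t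

nCk≤∑C : ∀ k {n t} → n < t → n C k ≤ ∑C k t
nCk≤∑C k {n} {suc t} n<1+t with m≤n⇒m<n∨m≡n (s≤s⁻¹ n<1+t)
... | inj₂ refl = m≤m+n (n C k) (∑C k n)
... | inj₁ n<t  = ≤-trans (nCk≤∑C k n<t) (m≤n+m (∑C k t) (t C k))

odd : ℕ → Bool
odd zero    = false
odd (suc a) = not (odd a)

-- Here c = k − 2q and r = q − 1, and w is the largest even number up to L.
module Patterns (c r : ℕ) (c≤1+r : c ≤ suc r)
                (w p o : ℕ) (w+p≡ : w + p ≡ suc (c + r)) (p+o≡r : p + o ≡ r) (w-even : odd w ≡ false) where

  q ℓ L k m₁ m n₀ : ℕ
  q  = suc r
  ℓ  = c + r
  L  = suc ℓ
  k  = L + q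
  -- The size of A ∖ Z and the threshold n₀ need only be large enough.
  m₁ = suc L + (2 + (q + L))
  m  = L + m₁
  n₀ = m + (m + (2 + q))

  q≤m : q ≤ m
  q≤m = begin
    q                       ≤⟨ m≤m+n q L ⟩
    q + L                   ≤⟨ m≤n+m (q + L) 2 ⟩
    2 + (q + L)             ≤⟨ m≤n+m (2 + (q + L)) (suc L) ⟩
    m₁                      ≤⟨ m≤n+m m₁ L ⟩
    m                       ∎
    where open ≤-Reasoning

  p≤r : p ≤ r
  p≤r = subst (p ≤_) p+o≡r (m≤m+n p o)

  record Frame {n} (A Z : Subset n) : Set where
    field
      ∣A∣ : ∣ A ∣ ≡ m
      ∣Z∣ : ∣ Z ∣ ≡ L
      Z⊆A : Z ⊆ A

    ∣A∖Z∣ : ∣ A ∩ ∁ Z ∣ ≡ m₁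
    ∣A∖Z∣ = +-cancelˡ-≡ L _ _ (begin
      L + ∣ A ∩ ∁ Z ∣            ≡⟨ cong (_+ ∣ A ∩ ∁ Z ∣) ∣Z∣ ⟨
      ∣ Z ∣ + ∣ A ∩ ∁ Z ∣        ≡⟨ cong (_+ ∣ A ∩ ∁ Z ∣) (∩-card-⊆ Z A Z⊆A) ⟨
      ∣ Z ∩ A ∣ + ∣ A ∩ ∁ Z ∣    ≡⟨ cong (_+ ∣ A ∩ ∁ Z ∣) (∩-card-comm Z A) ⟩
      ∣ A ∩ Z ∣ + ∣ A ∩ ∁ Z ∣    ≡⟨ ∣∣-split A Z ⟨
      ∣ A ∣                      ≡⟨ ∣A∣ ⟩
      m                          ∎)
      where open ≡-Reasoning

  Fits : ∀ {n} → Subset n → Subset n → Subset n → Bool → Set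
  Fits A Z d b = (∣ d ∩ A ∣ ≡ L → b ≡ odd ∣ d ∩ Z ∣) × (∣ d ∩ A ∣ ≡ suc L → b ≡ true)

  module _ {n} (n≥n₀ : n₀ ≤ n) where

    -- This is what `n₀` is made for: outside `A` there is room either to discard a second vertex
    -- set of size `m` and keep `q` vertices, or to give up two vertices to `avoid₂` and keep `q`.
    ∣∁A∣≥ : (A : Subset n) → ∣ A ∣ ≡ m → m + (2 + q) ≤ ∣ ∁ A ∣
    ∣∁A∣≥ A ∣A∣ = +-cancelˡ-≤ m _ _ (begin
      m + (m + (2 + q))   ≤⟨ n≥n₀ ⟩
      n                   ≡⟨ ∣⊤∣≡n n ⟨
      ∣ full {n} ∣                    ≡⟨ ∣∣-split full A ⟩
      ∣ full ∩ A ∣ + ∣ full ∩ ∁ A ∣   ≤⟨ +-mono-≤ (∣p∩q∣≤∣q∣ full A) (∣p∩q∣≤∣q∣ full (∁ A)) ⟩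
      ∣ A ∣ + ∣ ∁ A ∣     ≡⟨ cong (_+ ∣ ∁ A ∣) ∣A∣ ⟩
      m + ∣ ∁ A ∣         ∎)
      where open ≤-Reasoning

    ∁-pool : (A B : Subset n) → ∣ A ∣ ≡ m → ∣ B ∣ ≡ m → q ≤ ∣ ∁ A ∩ ∁ B ∣
    ∁-pool A B ∣A∣ ∣B∣ = ≤-trans (m≤n+m q 2)
      (∩∁-card-≥ {a = m} (∁ A) B (∣∁A∣≥ A ∣A∣) (subst (∣ ∁ A ∩ B ∣ ≤_) ∣B∣ (∣p∩q∣≤∣q∣ (∁ A) B)))

  -- Disagreement of two patterns away from two edges

  module _ {n} (v : KSubset n k → Bool) (e e′ : Subset n) (n≥n₀ : n₀ ≤ n) where

    -- In the application `v` is a 0-input and `e`, `e′` are the two flipped edges. Away from them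
    -- `v` agrees with both flipped inputs, so it must fit both patterns there.
    FitsOff : Subset n → Subset n → Set
    FitsOff A Z = ∀ d → proj₁ d ≢ e × proj₁ d ≢ e′ → Fits A Z (proj₁ d) (v d)

    -- Even parity on `Z` makes the first pattern demand 0 on `d`, whereas L + 1 vertices in `B`
    -- would make the second demand 1.
    clash : ∀ {A Z B Y} (d : KSubset n k) → proj₁ d ≢ e × proj₁ d ≢ e′ → FitsOff A Z → FitsOff B Y →
            ∣ proj₁ d ∩ A ∣ ≡ L → odd ∣ proj₁ d ∩ Z ∣ ≡ false → ∣ proj₁ d ∩ B ∣ ≢ suc L
    clash d d≢ fitsA fitsB dA dZ dB = contradiction
      (trans (sym (proj₂ (fitsB d d≢) dB)) (trans (proj₁ (fitsA d d≢) dA) dZ)) (λ ())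

    -- From `d` to `d′` the first pattern demands a change of value, since the parity on `Z`
    -- changes; equal intersections with `Y` would make the second pattern demand the same value
    -- twice.
    clash-exchange : ∀ {A Z B Y} (d d′ : KSubset n k) →
      proj₁ d ≢ e × proj₁ d ≢ e′ → proj₁ d′ ≢ e × proj₁ d′ ≢ e′ → FitsOff A Z → FitsOff B Y →
      ∣ proj₁ d ∩ A ∣ ≡ L → ∣ proj₁ d′ ∩ A ∣ ≡ L → ∣ proj₁ d ∩ B ∣ ≡ L → ∣ proj₁ d′ ∩ B ∣ ≡ L →
      ∣ proj₁ d ∩ Z ∣ ≡ suc ∣ proj₁ d′ ∩ Z ∣ → ∣ proj₁ d ∩ Y ∣ ≢ ∣ proj₁ d′ ∩ Y ∣
    clash-exchange {A} {Z} {B} {Y} d@(D , _) d′@(D′ , _) d≢ d′≢ fitsA fitsB dA d′A dB d′B dZ dY =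
      Bool.not-¬ refl (sym (begin
      not (odd ∣ D′ ∩ Z ∣)   ≡⟨ cong odd dZ ⟨
      odd ∣ D ∩ Z ∣          ≡⟨ proj₁ (fitsA d d≢) dA ⟨
      v d                    ≡⟨ proj₁ (fitsB d d≢) dB ⟩
      odd ∣ D ∩ Y ∣          ≡⟨ cong odd dY ⟩
      odd ∣ D′ ∩ Y ∣         ≡⟨ proj₁ (fitsB d′ d′≢) d′B ⟨
      v d′                   ≡⟨ proj₁ (fitsA d′ d′≢) d′A ⟩
      odd ∣ D′ ∩ Z ∣         ∎))
      where open ≡-Reasoning


    -- Exchanging a ∈ Z for a′ ∉ Z changes the parity required by (A , Z) but not the one
    -- required by (B , Y); W, taken from the pool Q, keeps both edges away from e and e′.
    exchange : ∀ {A Z B Y P Q W : Subset n} {Ss a a′} → FitsOff A Z → FitsOff B Y →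
      (∀ {K D} → Nonempty K → K ⊆ Q → Disjoint P D → K ∪ D ≢ e × K ∪ D ≢ e′) →
      Q ⊆ P → Disjoint P A → W ⊆ Q → ∣ W ∣ ≡ q → Z ⊆ A →
      All (_⊆ A) Ss → AllPairs Disjoint Ss → Meets full Ss ℓ → Meets A Ss ℓ →
      a ∈ Z → a′ ∈ A → a′ ∉ Z → a ∉ Y → a′ ∉ Y → All (a ∉_) Ss → All (a′ ∉_) Ss →
      Meets B (W ∷ ⁅ a ⁆ ∷ Ss) L → ¬ Meets B (W ∷ ⁅ a′ ⁆ ∷ Ss) L
    exchange {A} {Z} {B} {Y} {P} {Q} {W} {Ss} {a} {a′} fitsA fitsB avoids Q⊆P P∥A W⊆Q ∣W∣ Z⊆A
             Ss⊆A Ss-disj ∣Ss∣ ∣Ss∩A∣ a∈Z a′∈A a′∉Z a∉Y a′∉Y a∉Ss a′∉Ss ∣d∩B∣ ∣d′∩B∣ =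
      clash-exchange (edge (Z⊆A a∈Z) a∉Ss) (edge a′∈A a′∉Ss) (≢e (Z⊆A a∈Z)) (≢e a′∈A) fitsA fitsB
        (∣edge∩A∣ (Z⊆A a∈Z) a∉Ss) (∣edge∩A∣ a′∈A a′∉Ss)
        (meets (disj (Z⊆A a∈Z) a∉Ss) ∣d∩B∣) (meets (disj a′∈A a′∉Ss) ∣d′∩B∣)
        (trans (meets (disj (Z⊆A a∈Z) a∉Ss) (dis W∥Z (sub (⁅⁆-⊆ a∈Z) (∣⁅x⁆∣≡1 a) Ss∩Z)))
               (cong suc (sym (meets (disj a′∈A a′∉Ss) (dis W∥Z (dis (⁅⁆-disjoint a′∉Z) Ss∩Z))))))
        -- How `W` and the pieces in `Ss` meet `Y` is unknown, but both edges contain them and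
        -- neither `a` nor `a′` lies in `Y`, so both counts are the same unevaluated number.
        (trans (meets (disj (Z⊆A a∈Z) a∉Ss) (any (dis (⁅⁆-disjoint a∉Y) Ss∩Y)))
               (sym (meets (disj a′∈A a′∉Ss) (any (dis (⁅⁆-disjoint a′∉Y) Ss∩Y)))))
      where
      W∥A : Disjoint W A
      W∥A y∈W = P∥A (Q⊆P (W⊆Q y∈W))

      W∥Z : Disjoint W Z
      W∥Z y∈W y∈Z = W∥A y∈W (Z⊆A y∈Z)

      Ss∩Z = proj₂ (meets-any Z Ss)
      Ss∩Y = proj₂ (meets-any Y Ss)

      disj : ∀ {y} → y ∈ A → All (y ∉_) Ss → AllPairs Disjoint (W ∷ ⁅ y ⁆ ∷ Ss)
      disj y∈A y∉Ss =
        disjoint-⊆ W∥A (⁅⁆-⊆ y∈A ∷ Ss⊆A) ∷ ⁅⁆-disjoints y∉Ss ∷ Ss-disj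

      edge : ∀ {y} → y ∈ A → All (y ∉_) Ss → KSubset n k
      edge {y} y∈A y∉Ss = ⋃ (W ∷ ⁅ y ⁆ ∷ Ss) ,
        trans (∣⋃∣ (disj y∈A y∉Ss) (sub ⊆⊤ ∣W∣ (sub ⊆⊤ (∣⁅x⁆∣≡1 y) ∣Ss∣))) (+-comm q L)

      ∣edge∩A∣ : ∀ {y} (y∈A : y ∈ A) (y∉Ss : All (y ∉_) Ss) → ∣ ⋃ (W ∷ ⁅ y ⁆ ∷ Ss) ∩ A ∣ ≡ L
      ∣edge∩A∣ {y} y∈A y∉Ss = meets (disj y∈A y∉Ss) (dis W∥A (sub (⁅⁆-⊆ y∈A) (∣⁅x⁆∣≡1 y) ∣Ss∩A∣))

      ≢e : ∀ {y} → y ∈ A → ⋃ (W ∷ ⁅ y ⁆ ∷ Ss) ≢ e × ⋃ (W ∷ ⁅ y ⁆ ∷ Ss) ≢ e′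
      ≢e {y} y∈A = avoids (element-suc W ∣W∣) W⊆Q
        (⋃-disjoint (disjoint-⊆ P∥A (⁅⁆-⊆ y∈A ∷ Ss⊆A)))

    module _ {A Z B Y} (FA : Frame A Z) (FB : Frame B Y) (fitsA : FitsOff A Z) (fitsB : FitsOff B Y) where
      private
        module FA = Frame FA
        module FB = Frame FB
        A₁ = A ∩ ∁ Z

      -- The edge consists of L vertices of `A₁ ∩ B`, one vertex `b` of `B` outside `A`, and `r`
      -- vertices outside both: it has L vertices in `A`, none in `Z`, and L + 1 in `B`. The 2 in
      -- the bound pays for `avoid₂`.
      clash-large : A ≢ B → ¬ (2 + L ≤ ∣ A₁ ∩ B ∣)
      clash-large A≢B large
        with b , b∈ ← ∖-nonempty B A (trans FB.∣A∣ (sym FA.∣A∣)) (A≢B ∘ sym)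
        with Q , Q⊆P , ∣P∣≤ , avoids ← avoid₂ (A₁ ∩ B) e e′
        with K , K⊆Q , ∣K∣ ← choose Q (s≤s⁻¹ (s≤s⁻¹ (≤-trans large ∣P∣≤)))
        with O , O⊆ , ∣O∣ ← choose (∁ A ∩ ∁ B) (≤-trans (m≤n+m r 1) (∁-pool n≥n₀ A B FA.∣A∣ FB.∣A∣))
        = clash (⋃ Ks , trans (∣⋃∣ disj (sub ⊆⊤ ∣K∣ (sub ⊆⊤ (∣⁅x⁆∣≡1 b) (sub ⊆⊤ ∣O∣ []))))
                       (cong (λ t → L + suc t) (+-identityʳ r)))
            (avoids (element-suc K ∣K∣) K⊆Q
              (⋃-disjoint ((λ y∈P → disjoint-⁅⁆ b∉A (P⊆A y∈P)) ∷ (λ y∈P y∈O → O∉A y∈O (P⊆A y∈P)) ∷ [])))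
            fitsA fitsB
            (trans (meets disj (sub K⊆A ∣K∣ (dis (⁅⁆-disjoint b∉A) (dis O∉A [])))) (+-identityʳ L))
            (cong odd (meets disj (dis (λ y∈K → ∈∩∁⇒∉ A Z (p∩q⊆p A₁ B (Q⊆P (K⊆Q y∈K))))
              (dis (⁅⁆-disjoint b∉Z) (dis (λ y∈O y∈Z → O∉A y∈O (FA.Z⊆A y∈Z)) [])))))
            (trans (meets disj (sub K⊆B ∣K∣ (sub (⁅⁆-⊆ b∈B) (∣⁅x⁆∣≡1 b) (dis O∉B [])))) (+-comm L 1))
        where
        Ks : List (Subset n)
        Ks = K ∷ ⁅ b ⁆ ∷ O ∷ []

        b∈B : b ∈ B
        b∈B = p∩q⊆p B (∁ A) b∈

        b∉A : b ∉ A
        b∉A = ∈∩∁⇒∉ B A b∈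

        b∉Z : b ∉ Z
        b∉Z = b∉A ∘ FA.Z⊆A

        P⊆A : A₁ ∩ B ⊆ A
        P⊆A y∈P = p∩q⊆p A (∁ Z) (p∩q⊆p A₁ B y∈P)

        K⊆A : K ⊆ A
        K⊆A y∈K = P⊆A (Q⊆P (K⊆Q y∈K))

        K⊆B : K ⊆ B
        K⊆B y∈K = p∩q⊆q A₁ B (Q⊆P (K⊆Q y∈K))

        O∉A : Disjoint O A
        O∉A y∈O = x∈∁p⇒x∉p (p∩q⊆p (∁ A) (∁ B) (O⊆ y∈O))

        O∉B : Disjoint O B
        O∉B y∈O = ∈∩∁⇒∉ (∁ A) B (O⊆ y∈O)

        disj : AllPairs Disjoint Ks
        disj = ((λ y∈K → disjoint-⁅⁆ b∉A (K⊆A y∈K)) ∷ (λ y∈K y∈O → O∉A y∈O (K⊆A y∈K)) ∷ []) ∷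
               ((λ y∈b y∈O → O∉B y∈O (⁅⁆-⊆ b∈B y∈b)) ∷ []) ∷ [] ∷ []

      -- w vertices of Z and p of A ∖ Z ∖ B make up the L vertices in A, so ∣ d ∩ Z ∣ = w is even.
      clash-Z⊆B : Z ⊆ B → 2 + (q + L) ≤ ∣ A₁ ∩ ∁ B ∣ → ¬ (2 + (q + L) ≤ ∣ B ∩ ∁ A ∣)
      clash-Z⊆B Z⊆B A-large B-large
        with Q , Q⊆P , ∣P∣≤ , avoids ← avoid₂ (B ∩ ∁ A) e e′
        -- `W` has one vertex more than the piece `T` of size `p` that lies in `A` but not in `B`.
        -- Hence L = w + p vertices in `A` go with L + 1 in `B`, and `o` vertices outside both
        -- complete the edge, as p + o = r.
        with W , W⊆Q , ∣W∣ ← choose Q {suc p}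
               (≤-trans (s≤s p≤r) (≤-trans (m≤m+n q L) (s≤s⁻¹ (s≤s⁻¹ (≤-trans B-large ∣P∣≤)))))
        with K , K⊆Z , ∣K∣ ← choose Z {w} (subst (w ≤_) (trans w+p≡ (sym FA.∣Z∣)) (m≤m+n w p))
        with T , T⊆ , ∣T∣ ← choose (A₁ ∩ ∁ B) {p}
               (≤-trans (≤-trans p≤r (≤-trans (m≤n+m r 3) (m≤m+n (2 + q) L))) A-large)
        with O , O⊆ , ∣O∣ ← choose (∁ A ∩ ∁ B) {o}
               (≤-trans (≤-trans (m≤n+m o p) (≤-trans (≤-reflexive p+o≡r) (m≤n+m r 1)))
                        (∁-pool n≥n₀ A B FA.∣A∣ FB.∣A∣))
        = clash (⋃ Ks , trans (∣⋃∣ disj (sub ⊆⊤ ∣W∣ (sub ⊆⊤ ∣K∣ (sub ⊆⊤ ∣T∣ (sub ⊆⊤ ∣O∣ []))))) ∣d∣≡k)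
            (avoids (element-suc W ∣W∣) W⊆Q
              (⋃-disjoint ((λ y∈P y∈K → P∥A y∈P (FA.Z⊆A (K⊆Z y∈K))) ∷ (λ y∈P y∈T → P∥A y∈P (T⊆A y∈T)) ∷
                            (λ y∈P y∈O → O∉B y∈O (p∩q⊆p B (∁ A) y∈P)) ∷ [])))
            fitsA fitsB
            (trans (meets disj (dis W∉A (sub (λ y∈K → FA.Z⊆A (K⊆Z y∈K)) ∣K∣ (sub T⊆A ∣T∣ (dis O∉A [])))))
                   (trans (cong (w +_) (+-identityʳ p)) w+p≡))
            (trans (cong odd (trans (meets disj (dis (λ y∈W y∈Z → W∉A y∈W (FA.Z⊆A y∈Z))
                     (sub K⊆Z ∣K∣ (dis T∉Z (dis (λ y∈O y∈Z → O∉A y∈O (FA.Z⊆A y∈Z)) [])))))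
                     (+-identityʳ w)))
                   w-even)
            (trans (meets disj (sub W⊆B ∣W∣ (sub (λ y∈K → Z⊆B (K⊆Z y∈K)) ∣K∣ (dis T∉B (dis O∉B [])))))
                   (trans (cong (suc p +_) (+-identityʳ w)) (cong suc (trans (+-comm p w) w+p≡))))
        where
        Ks : List (Subset n)
        Ks = W ∷ K ∷ T ∷ O ∷ []

        P∥A : Disjoint (B ∩ ∁ A) A
        P∥A = ∈∩∁⇒∉ B A

        W∉A : Disjoint W A
        W∉A y∈W = P∥A (Q⊆P (W⊆Q y∈W))

        W⊆B : W ⊆ B
        W⊆B y∈W = p∩q⊆p B (∁ A) (Q⊆P (W⊆Q y∈W))

        T⊆A : T ⊆ A
        T⊆A y∈T = p∩q⊆p A (∁ Z) (p∩q⊆p A₁ (∁ B) (T⊆ y∈T))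

        T∉Z : Disjoint T Z
        T∉Z y∈T = ∈∩∁⇒∉ A Z (p∩q⊆p A₁ (∁ B) (T⊆ y∈T))

        T∉B : Disjoint T B
        T∉B y∈T = ∈∩∁⇒∉ A₁ B (T⊆ y∈T)

        O∉A : Disjoint O A
        O∉A y∈O = x∈∁p⇒x∉p (p∩q⊆p (∁ A) (∁ B) (O⊆ y∈O))

        O∉B : Disjoint O B
        O∉B y∈O = ∈∩∁⇒∉ (∁ A) B (O⊆ y∈O)

        disj : AllPairs Disjoint Ks
        disj = ((λ y∈W y∈K → W∉A y∈W (FA.Z⊆A (K⊆Z y∈K))) ∷ (λ y∈W y∈T → W∉A y∈W (T⊆A y∈T)) ∷
                (λ y∈W y∈O → O∉B y∈O (W⊆B y∈W)) ∷ []) ∷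
               ((λ y∈K y∈T → T∉Z y∈T (K⊆Z y∈K)) ∷ (λ y∈K y∈O → O∉B y∈O (Z⊆B (K⊆Z y∈K))) ∷ []) ∷
               ((λ y∈T y∈O → O∉A y∈O (T⊆A y∈T)) ∷ []) ∷ [] ∷ []

        ∣d∣≡k : suc p + (w + (p + (o + 0))) ≡ k
        ∣d∣≡k = begin
          suc p + (w + (p + (o + 0)))   ≡⟨ cong (λ t → suc p + (w + (p + t))) (+-identityʳ o) ⟩
          suc p + (w + (p + o))         ≡⟨ cong (λ t → suc p + (w + t)) p+o≡r ⟩
          suc p + (w + r)               ≡⟨ cong suc (+-assoc p w r) ⟨
          suc (p + w + r)               ≡⟨ cong (λ t → suc (t + r)) (trans (+-comm p w) w+p≡) ⟩
          suc (L + r)                   ≡⟨ +-suc L r ⟨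
          k                             ∎
          where open ≡-Reasoning

      -- Besides `a` or `a′`, the edges have `q` vertices only in `B`, `c` in both sets and `r` only
      -- in `A`. This gives 1 + c + r = L vertices in `A` and q + c = L in `B`, which is why `c`
      -- common vertices are required. Both `a` and `a′` lie outside `B`, hence outside `Y`.
      clash-Z⊈B : Nonempty (Z ∩ ∁ B) → c ≤ ∣ A ∩ B ∣ →
                  2 + (q + L) ≤ ∣ A₁ ∩ ∁ B ∣ → ¬ (2 + (q + L) ≤ ∣ B ∩ ∁ A ∣)
      clash-Z⊈B (a , a∈) c≤∣A∩B∣ A-large B-large
        with Q , Q⊆P , ∣P∣≤ , avoids ← avoid₂ (B ∩ ∁ A) e e′
        with W , W⊆Q , ∣W∣ ← choose Q {q} (≤-trans (m≤m+n q L) (s≤s⁻¹ (s≤s⁻¹ (≤-trans B-large ∣P∣≤))))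
        with K , K⊆ , ∣K∣ ← choose (A ∩ B) c≤∣A∩B∣
        with a′ , a′∈ ← element (A₁ ∩ ∁ B) (≤-trans (s≤s z≤n) A-large)
        with T , T⊆ , ∣T∣ ← choose ((A₁ ∩ ∁ B) ∩ ∁ ⁅ a′ ⁆) {r} (∩∁-card-≥ {a = 1} (A₁ ∩ ∁ B) ⁅ a′ ⁆
               (≤-trans (≤-trans (m≤m+n q L) (m≤n+m (q + L) 2)) A-large)
               (subst (∣ (A₁ ∩ ∁ B) ∩ ⁅ a′ ⁆ ∣ ≤_) (∣⁅x⁆∣≡1 a′) (∣p∩q∣≤∣q∣ (A₁ ∩ ∁ B) ⁅ a′ ⁆)))
        = exchange fitsA fitsB avoids Q⊆P (∈∩∁⇒∉ B A) W⊆Q ∣W∣ FA.Z⊆A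
            (K⊆A ∷ T⊆A ∷ [])
            (((λ y∈K y∈T → T∉B y∈T (K⊆B y∈K)) ∷ []) ∷ [] ∷ [])
            (subst (Meets full _) ∣Ss∣ (sub ⊆⊤ ∣K∣ (sub ⊆⊤ ∣T∣ [])))
            (subst (Meets A _) ∣Ss∣ (sub K⊆A ∣K∣ (sub T⊆A ∣T∣ [])))
            (p∩q⊆p Z (∁ B) a∈) (p∩q⊆p A (∁ Z) (p∩q⊆p A₁ (∁ B) a′∈))
            (∈∩∁⇒∉ A Z (p∩q⊆p A₁ (∁ B) a′∈)) (a∉B ∘ FB.Z⊆A) (a′∉B ∘ FB.Z⊆A)
            ((λ a∈K → a∉B (K⊆B a∈K)) ∷ (λ a∈T → T∉Z a∈T (p∩q⊆p Z (∁ B) a∈)) ∷ [])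
            ((λ a′∈K → a′∉B (K⊆B a′∈K)) ∷ (λ a′∈T → ∈∩∁⇒∉ (A₁ ∩ ∁ B) ⁅ a′ ⁆ (T⊆ a′∈T) (x∈⁅x⁆ a′)) ∷ [])
            (∣d∩B∣ a∉B) (∣d∩B∣ a′∉B)
        where
        a∉B : a ∉ B
        a∉B = ∈∩∁⇒∉ Z B a∈

        a′∉B : a′ ∉ B
        a′∉B = ∈∩∁⇒∉ A₁ B a′∈

        K⊆A : K ⊆ A
        K⊆A y∈K = p∩q⊆p A B (K⊆ y∈K)

        K⊆B : K ⊆ B
        K⊆B y∈K = p∩q⊆q A B (K⊆ y∈K)

        T⊆A₁∖B : T ⊆ A₁ ∩ ∁ B
        T⊆A₁∖B y∈T = p∩q⊆p (A₁ ∩ ∁ B) (∁ ⁅ a′ ⁆) (T⊆ y∈T)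

        T∉B : Disjoint T B
        T∉B y∈T = ∈∩∁⇒∉ A₁ B (T⊆A₁∖B y∈T)

        T⊆A : T ⊆ A
        T⊆A y∈T = p∩q⊆p A (∁ Z) (p∩q⊆p A₁ (∁ B) (T⊆A₁∖B y∈T))

        T∉Z : Disjoint T Z
        T∉Z y∈T = ∈∩∁⇒∉ A Z (p∩q⊆p A₁ (∁ B) (T⊆A₁∖B y∈T))

        ∣Ss∣ : c + (r + 0) ≡ ℓ
        ∣Ss∣ = cong (c +_) (+-identityʳ r)

        ∣d∩B∣ : ∀ {y} → y ∉ B → Meets B (W ∷ ⁅ y ⁆ ∷ K ∷ T ∷ []) L
        ∣d∩B∣ y∉B = subst (Meets B _) (cong suc (trans (cong (r +_) (+-identityʳ c)) (+-comm r c)))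
          (sub (λ y∈W → p∩q⊆p B (∁ A) (Q⊆P (W⊆Q y∈W))) ∣W∣ (dis (⁅⁆-disjoint y∉B) (sub K⊆B ∣K∣ (dis T∉B []))))

    -- The size `m₁` is chosen as this sum: after a loss of at most L + 1 vertices there remain
    -- enough for every piece of the edges, with two to spare for `avoid₂`.
    ∣A∖Z∖S∣≥ : ∀ {A Z : Subset n} → Frame A Z → ∀ S →
                ∣ (A ∩ ∁ Z) ∩ S ∣ ≤ suc L → 2 + (q + L) ≤ ∣ (A ∩ ∁ Z) ∩ ∁ S ∣
    ∣A∖Z∖S∣≥ {A} {Z} FA S = ∩∁-card-≥ (A ∩ ∁ Z) S (≤-reflexive (sym (Frame.∣A∖Z∣ FA)))

    -- Here the edges have `q` vertices outside the common vertex set, so the exchange preserves L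
    -- on both sides. The other `ℓ` vertices avoid `Z` and `Y`, and thereby `a`. Decidable equality
    -- later removes the double negation.
    clash-Z≢Y : ∀ {A Z Y} → Frame A Z → Frame A Y → FitsOff A Z → FitsOff A Y → ¬ (Z ≢ Y)
    clash-Z≢Y {A} {Z} {Y} FA FB fitsA fitsB Z≢Y
      with A-large ← ∣A∖Z∖S∣≥ FA Y
             (≤-trans (∣p∩q∣≤∣q∣ (A ∩ ∁ Z) Y) (≤-trans (≤-reflexive (Frame.∣Z∣ FB)) (m≤n+m L 1)))
      with a , a∈ ← ∖-nonempty Z Y (trans (Frame.∣Z∣ FA) (sym (Frame.∣Z∣ FB))) Z≢Y
      with Q , Q⊆P , ∣P∣≤ , avoids ← avoid₂ (∁ A) e e′
      with W , W⊆Q , ∣W∣ ← choose Q {q}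
             (s≤s⁻¹ (s≤s⁻¹ (≤-trans (≤-trans (m≤n+m (2 + q) m) (∣∁A∣≥ n≥n₀ A (Frame.∣A∣ FA))) ∣P∣≤)))
      with a′ , a′∈ ← element ((A ∩ ∁ Z) ∩ ∁ Y) (≤-trans (s≤s z≤n) A-large)
      with S , S⊆ , ∣S∣ ← choose (((A ∩ ∁ Z) ∩ ∁ Y) ∩ ∁ ⁅ a′ ⁆) {ℓ}
             (∩∁-card-≥ {a = 1} ((A ∩ ∁ Z) ∩ ∁ Y) ⁅ a′ ⁆
               (≤-trans (m≤n+m L (2 + q)) A-large)
               (subst (∣ ((A ∩ ∁ Z) ∩ ∁ Y) ∩ ⁅ a′ ⁆ ∣ ≤_) (∣⁅x⁆∣≡1 a′) (∣p∩q∣≤∣q∣ ((A ∩ ∁ Z) ∩ ∁ Y) ⁅ a′ ⁆)))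
      = exchange fitsA fitsB avoids Q⊆P (λ y∈ → x∈∁p⇒x∉p y∈) W⊆Q ∣W∣ FA.Z⊆A
          (S⊆A ∷ []) ([] ∷ [])
          (subst (Meets full _) (+-identityʳ ℓ) (sub ⊆⊤ ∣S∣ []))
          (subst (Meets A _) (+-identityʳ ℓ) (sub S⊆A ∣S∣ []))
          a∈Z a′∈A (∈∩∁⇒∉ A Z (p∩q⊆p A₁ (∁ Y) a′∈)) (∈∩∁⇒∉ Z Y a∈) (∈∩∁⇒∉ A₁ Y a′∈)
          ((λ a∈S → ∈∩∁⇒∉ A Z (p∩q⊆p A₁ (∁ Y) (S⊆A₁∖Y a∈S)) a∈Z) ∷ [])
          ((λ a′∈S → ∈∩∁⇒∉ (A₁ ∩ ∁ Y) ⁅ a′ ⁆ (S⊆ a′∈S) (x∈⁅x⁆ a′)) ∷ [])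
          (∣d∩A∣ (FA.Z⊆A a∈Z)) (∣d∩A∣ a′∈A)
      where
      module FA = Frame FA
      module FB = Frame FB
      A₁ = A ∩ ∁ Z
      a∈Z = p∩q⊆p Z (∁ Y) a∈
      a′∈A = p∩q⊆p A (∁ Z) (p∩q⊆p A₁ (∁ Y) a′∈)

      S⊆A₁∖Y : S ⊆ A₁ ∩ ∁ Y
      S⊆A₁∖Y y∈S = p∩q⊆p (A₁ ∩ ∁ Y) (∁ ⁅ a′ ⁆) (S⊆ y∈S)

      S⊆A : S ⊆ A
      S⊆A y∈S = p∩q⊆p A (∁ Z) (p∩q⊆p A₁ (∁ Y) (S⊆A₁∖Y y∈S))

      ∣d∩A∣ : ∀ {y} → y ∈ A → Meets A (W ∷ ⁅ y ⁆ ∷ S ∷ []) L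
      ∣d∩A∣ {y} y∈A = subst (Meets A _) (cong suc (+-identityʳ ℓ))
        (dis (λ y∈W → x∈∁p⇒x∉p (Q⊆P (W⊆Q y∈W))) (sub (⁅⁆-⊆ y∈A) (∣⁅x⁆∣≡1 y) (sub S⊆A ∣S∣ [])))

    frames-agree : ∀ {A Z B Y} → Frame A Z → Frame B Y → FitsOff A Z → FitsOff B Y →
                   c ≤ ∣ A ∩ B ∣ → A ≡ B × Z ≡ Y
    frames-agree {A} {Z} {B} {Y} FA FB fitsA fitsB c≤∣A∩B∣ with ≡-dec Bool._≟_ A B
    ... | yes refl = refl , decidable-stable (≡-dec Bool._≟_ Z Y) (clash-Z≢Y FA FB fitsA fitsB)
    ... | no A≢B with 2 + L ≤? ∣ (A ∩ ∁ Z) ∩ B ∣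
    ...   | yes large = contradiction large (clash-large FA FB fitsA fitsB A≢B)
    ...   | no ¬large = contradiction (B∖A-large A₁∖B-large) (decided (nonempty? (Z ∩ ∁ B)))
      where
      A₁∖B-large : 2 + (q + L) ≤ ∣ (A ∩ ∁ Z) ∩ ∁ B ∣
      A₁∖B-large = ∣A∖Z∖S∣≥ FA B (s≤s⁻¹ (≰⇒> ¬large))

      -- Vertex sets of equal size have differences of equal size, so the room found on the side of
      -- `A` is also available on the side of `B`.
      B∖A-large : 2 + (q + L) ≤ ∣ (A ∩ ∁ Z) ∩ ∁ B ∣ → 2 + (q + L) ≤ ∣ B ∩ ∁ A ∣
      B∖A-large A₁-large = begin
        2 + (q + L)             ≤⟨ A₁-large ⟩
        ∣ (A ∩ ∁ Z) ∩ ∁ B ∣     ≤⟨ p⊆q⇒∣p∣≤∣q∣ (λ y∈ → x∈p∩q⁺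
                                       (p∩q⊆p A (∁ Z) (p∩q⊆p (A ∩ ∁ Z) (∁ B) y∈) , p∩q⊆q (A ∩ ∁ Z) (∁ B) y∈)) ⟩
        ∣ A ∩ ∁ B ∣             ≡⟨ ∩∁-card-comm A B (trans (Frame.∣A∣ FA) (sym (Frame.∣A∣ FB))) ⟩
        ∣ B ∩ ∁ A ∣             ∎
        where open ≤-Reasoning

      decided : Dec (Nonempty (Z ∩ ∁ B)) → ¬ (2 + (q + L) ≤ ∣ B ∩ ∁ A ∣)
      decided (yes Z⊈B) = clash-Z⊈B FA FB fitsA fitsB Z⊈B c≤∣A∩B∣ A₁∖B-large
      decided (no Z∖B-empty) = clash-Z⊆B FA FB fitsA fitsB
        (∩∁≡0⇒⊆ Z B (trans (cong ∣_∣ (Empty-unique Z∖B-empty)) (∣⊥∣≡0 n))) A₁∖B-large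

  -- The function `f`: invariance, sensitivity and non-constancy

  frame? : ∀ {n} (A Z : Subset n) → Dec (Frame A Z)
  frame? A Z = map′ to from (∣ A ∣ ℕ.≟ m ×-dec ∣ Z ∣ ℕ.≟ L ×-dec Z ⊆? A)
    where
    to : ∣ A ∣ ≡ m × ∣ Z ∣ ≡ L × Z ⊆ A → Frame A Z
    to (∣A∣ , ∣Z∣ , Z⊆A) = record { ∣A∣ = ∣A∣ ; ∣Z∣ = ∣Z∣ ; Z⊆A = Z⊆A }

    from : Frame A Z → ∣ A ∣ ≡ m × ∣ Z ∣ ≡ L × Z ⊆ A
    from F = Frame.∣A∣ F , Frame.∣Z∣ F , Frame.Z⊆A F

  fits? : ∀ {n} (A Z d : Subset n) b → Dec (Fits A Z d b)
  fits? A Z d b =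
    (∣ d ∩ A ∣ ℕ.≟ L →-dec b Bool.≟ odd ∣ d ∩ Z ∣) ×-dec (∣ d ∩ A ∣ ℕ.≟ suc L →-dec b Bool.≟ true)

  module _ {n : ℕ} where

    edge : Fin (n C k) → Subset n
    edge i = proj₁ (kSubset {n} {k} i)

    edge-index : ∀ (d : KSubset n k) → edge (index {n} {k} d) ≡ proj₁ d
    edge-index d = cong proj₁ (Inverse.strictlyInverseˡ (enumerate n k) d)

    Matches : Vec Bool (n C k) → Subset n → Subset n → Set
    Matches x A Z = Frame A Z × (∀ i → Fits A Z (edge i) (lookup x i))

    Good : Vec Bool (n C k) → Set
    Good x = ∃[ A ] ∃[ Z ] Matches x A Z

    good? : ∀ x → Dec (Good x)
    good? x = anySubset? λ A → anySubset? λ Z →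
      frame? A Z ×-dec all? λ i → fits? A Z (edge i) (lookup x i)

    -- The relabelled input reads `x` at the image of an edge under `σ`, so its pattern is the one
    -- of `x` carried back by the inverse permutation.
    good-relabel : ∀ σ x → Good x → Good (relabel {n} {k} σ x)
    good-relabel σ x (A , Z , FA , fits) = image (flip σ) A , image (flip σ) Z ,
      record { ∣A∣ = trans (∣image∣ (flip σ) A) FA.∣A∣ ; ∣Z∣ = trans (∣image∣ (flip σ) Z) FA.∣Z∣
             ; Z⊆A = image-mono (flip σ) FA.Z⊆A } ,
      λ i → relabel-fits i (subst₂ (Fits A Z)
        (edge-index (kImage σ (kSubset {n} {k} i))) (sym (lookup-relabel {n} {k} σ x i))
        (fits (index {n} {k} (kImage σ (kSubset {n} {k} i)))))
      where
      module FA = Frame FA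

      relabel-fits : ∀ i {b} → Fits A Z (image σ (edge i)) b →
                     Fits (image (flip σ) A) (image (flip σ) Z) (edge i) b
      relabel-fits i (fits-L , fits-sucL) =
        (λ eq → trans (fits-L (trans (∣image∩∣ σ (edge i) A) eq)) (cong odd (∣image∩∣ σ (edge i) Z))) ,
        (λ eq → fits-sucL (trans (∣image∩∣ σ (edge i) A) eq))

    fits-unflip : ∀ {x l A Z} → Matches (flipBit x l) A Z → ∀ i → i ≢ l → Fits A Z (edge i) (lookup x i)
    fits-unflip {x} {l} {A} {Z} (_ , fits) i i≢l =
      subst (Fits A Z (edge i)) (lookup∘updateAt′ i l i≢l x) (fits i)

    fits-off : ∀ {x l A Z} → Matches (flipBit x l) A Z → ∀ d → proj₁ d ≢ edge l →
               Fits A Z (proj₁ d) (lookup x (index {n} {k} d))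
    fits-off {x} {l} {A} {Z} M d d≢ = subst (λ e → Fits A Z e (lookup x (index {n} {k} d))) (edge-index d)
      (fits-unflip {x} M (index {n} {k} d) (λ eq → d≢ (trans (sym (edge-index d)) (cong edge eq))))

    -- If `i` and `j` differed, both flipped inputs would match the same pattern. Every bit is left
    -- untouched by at least one of the two flips, so `x` itself would match it.
    flips-agree : n₀ ≤ n → ∀ {x i j A Z B Y} → ¬ Good x →
                  Matches (flipBit x i) A Z → Matches (flipBit x j) B Y → c ≤ ∣ A ∩ B ∣ → i ≡ j
    flips-agree n≥n₀ {x} {i} {j} {A} {Z} ¬good Mᵢ Mⱼ c≤ with i Fin.≟ j
    ... | yes i≡j = i≡j
    ... | no  i≢j
      with refl , refl ← frames-agree (λ d → lookup x (index {n} {k} d)) (edge i) (edge j) n≥n₀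
                           (proj₁ Mᵢ) (proj₁ Mⱼ)
                           (λ d (d≢ , _) → fits-off {x} Mᵢ d d≢) (λ d (_ , d≢) → fits-off {x} Mⱼ d d≢) c≤
      = contradiction (A , Z , proj₁ Mᵢ , fits) ¬good
      where
      fits : ∀ l → Fits A Z (edge l) (lookup x l)
      fits l with l Fin.≟ i
      ... | yes refl = fits-unflip {x} Mⱼ l i≢j
      ... | no  l≢i  = fits-unflip {x} Mᵢ l l≢i

    f : BooleanFunction (n C k)
    f x = does (good? x)

    Sensitive : Vec Bool (n C k) → Fin (n C k) → Set
    Sensitive x i = f x ≢ f (flipBit x i)

    sensitive? : ∀ x i → Dec (Sensitive x i)
    sensitive? x i = ¬? (f x Bool.≟ f (flipBit x i))

    -- Flipping an edge with fewer than L vertices in `A` keeps the pattern, so `code` applies to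
    -- every sensitive edge: at most `2 ^ m` traces, and a `q`-set for the rest.
    sensitivity-good : ∀ x → Good x → sensitivityAt f x ≤ 2 ^ m * n ^ q
    sensitivity-good x good@(A , Z , FA , fits) = begin
      sensitivityAt f x       ≤⟨ count-≤ (sensitive? x) (λ i s → code A (kSubset {n} {k} i) (relevant i s))
                                   (λ i j s t eq → kSubset-injective {n} {k}
                                     (code-injective A _ _ (relevant i s) (relevant j t) eq)) ⟩
      2 ^ ∣ A ∣ * (n C q)     ≡⟨ cong (λ t → 2 ^ t * (n C q)) (Frame.∣A∣ FA) ⟩
      2 ^ m * (n C q)         ≤⟨ *-monoʳ-≤ (2 ^ m) (nCk≤n^k n q) ⟩
      2 ^ m * n ^ q           ∎
      where
      open ≤-Reasoning

      still-good : ∀ i → ¬ (L ≤ ∣ edge i ∩ A ∣) → Good (flipBit x i)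
      still-good i ∣∣≱L = A , Z , FA , fits′
        where
        fits′ : ∀ l → Fits A Z (edge l) (lookup (flipBit x i) l)
        fits′ l with l Fin.≟ i
        ... | yes refl = (λ eq → contradiction (≤-reflexive (sym eq)) ∣∣≱L) ,
                         (λ eq → contradiction (≤-trans (n≤1+n L) (≤-reflexive (sym eq))) ∣∣≱L)
        ... | no  l≢i  = subst (Fits A Z (edge l)) (sym (lookup∘updateAt′ l i l≢i x)) (fits l)

      relevant : ∀ i → Sensitive x i → L ≤ ∣ edge i ∩ A ∣
      relevant i s with L ≤? ∣ edge i ∩ A ∣
      ... | yes L≤ = L≤
      ... | no  L≰ = contradiction
        (trans (dec-true (good? x) good) (sym (dec-true (good? (flipBit x i)) (still-good i L≰)))) s

    sensitivity-bad : n₀ ≤ n → ∀ x → ¬ Good x → sensitivityAt f x ≤ n ^ q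
    sensitivity-bad n≥n₀ x ¬good = ≤-trans
      (count-≤ (sensitive? x) (λ i s → index {n} {q} (core i s))
        (λ i j s t eq → flips-agree n≥n₀ {x} ¬good (proj₂ (proj₂ (witness i s))) (proj₂ (proj₂ (witness j t)))
          (shared i j s t (cong proj₁ (index-injective {n} {q} eq)))))
      (nCk≤n^k n q)
      where
      witness : ∀ i → Sensitive x i → Good (flipBit x i)
      witness i s = does-true (good? (flipBit x i))
        (sym (trans (cong not (sym (dec-false (good? x) ¬good)))
          (trans (cong not (Bool.¬-not s)) (Bool.not-involutive (f (flipBit x i))))))

      chosen : ∀ i s → ∃[ K ] K ⊆ proj₁ (witness i s) × ∣ K ∣ ≡ q
      chosen i s = choose (proj₁ (witness i s))
        (subst (q ≤_) (sym (Frame.∣A∣ (proj₁ (proj₂ (proj₂ (witness i s)))))) q≤m)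

      core : ∀ i → Sensitive x i → KSubset n q
      core i s = proj₁ (chosen i s) , proj₂ (proj₂ (chosen i s))

      -- Equal codes place one `q`-set inside both vertex sets, and c is at most q.
      shared : ∀ i j s t → proj₁ (core i s) ≡ proj₁ (core j t) →
               c ≤ ∣ proj₁ (witness i s) ∩ proj₁ (witness j t) ∣
      shared i j s t eq = ≤-trans c≤1+r (≤-trans (≤-reflexive (sym (proj₂ (core i s))))
        (p⊆q⇒∣p∣≤∣q∣ λ {y} y∈ → x∈p∩q⁺
          (proj₁ (proj₂ (chosen i s)) y∈ , proj₁ (proj₂ (chosen j t)) (subst (y ∈_) eq y∈))))

    f-sensitivity : n₀ ≤ n → sensitivity f ≤ 2 ^ m * n ^ q
    f-sensitivity n≥n₀ = sensitivity-≤ f λ x → bound x (good? x)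
      where
      bound : ∀ x → Dec (Good x) → sensitivityAt f x ≤ 2 ^ m * n ^ q
      bound x (yes good) = sensitivity-good x good
      bound x (no ¬good) = ≤-trans (sensitivity-bad n≥n₀ x ¬good)
        (m≤n*m (n ^ q) (2 ^ m) {{>-nonZero (m^n>0 2 m)}})

    f-property : IsHypergraphProperty n k f
    f-property = relabel-closed⇒property {n} {k} good? good-relabel

    exists-good : n₀ ≤ n → ∃[ x ] Good x
    exists-good n≥n₀
      with A , _ , ∣A∣ ← choose (full {n}) {m}
             (subst (m ≤_) (sym (∣⊤∣≡n n)) (≤-trans (m≤m+n m (m + (2 + q))) n≥n₀))
      with Z , Z⊆A , ∣Z∣ ← choose A {L} (subst (L ≤_) (sym ∣A∣) (m≤m+n L m₁))
      = tabulate pattern-value , A , Z , record { ∣A∣ = ∣A∣ ; ∣Z∣ = ∣Z∣ ; Z⊆A = Z⊆A } , fits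
      where
      value : ∀ d → Dec (∣ d ∩ A ∣ ≡ L) → Bool
      value d (yes _) = odd ∣ d ∩ Z ∣
      -- This default meets the demand at L + 1; all remaining edges are unconstrained.
      value d (no  _) = true

      value-fits : ∀ d D → Fits A Z d (value d D)
      value-fits d (yes eq) = (λ _ → refl) , (λ eq′ → contradiction (trans (sym eq′) eq) 1+n≢n)
      value-fits d (no neq) = (λ eq → contradiction eq neq) , (λ _ → refl)

      pattern-value : Fin (n C k) → Bool
      pattern-value i = value (edge i) (∣ edge i ∩ A ∣ ℕ.≟ L)

      fits : ∀ i → Fits A Z (edge i) (lookup (tabulate pattern-value) i)
      fits i = subst (Fits A Z (edge i)) (sym (lookup∘tabulate pattern-value i))
        (value-fits (edge i) (∣ edge i ∩ A ∣ ℕ.≟ L))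

    -- Any pattern demands the value 1 on an edge with L + 1 vertices in `A` and `r` outside.
    all-false-bad : n₀ ≤ n → ¬ Good (replicate (n C k) false)
    all-false-bad n≥n₀ (A , Z , FA , fits)
      with K , K⊆A , ∣K∣ ← choose A {suc L}
             (subst (suc L ≤_) (sym (Frame.∣A∣ FA)) (≤-trans (m≤m+n (suc L) (2 + (q + L))) (m≤n+m m₁ L)))
      with O , O⊆ , ∣O∣ ← choose (∁ A) {r}
             (≤-trans (m≤n+m r 3) (≤-trans (m≤n+m (2 + q) m) (∣∁A∣≥ n≥n₀ A (Frame.∣A∣ FA))))
      = contradiction
          (trans (sym (lookup-replicate i false))
                 (proj₂ (fits i) (trans (cong (λ e → ∣ e ∩ A ∣) (edge-index d)) ∣d∩A∣)))
          (λ ())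
      where
      disj : AllPairs Disjoint (K ∷ O ∷ [])
      disj = ((λ y∈K y∈O → x∈∁p⇒x∉p (O⊆ y∈O) (K⊆A y∈K)) ∷ []) ∷ [] ∷ []

      d : KSubset n k
      d = ⋃ (K ∷ O ∷ []) , trans (∣⋃∣ disj (sub ⊆⊤ ∣K∣ (sub ⊆⊤ ∣O∣ [])))
            (trans (cong (suc L +_) (+-identityʳ r)) (sym (+-suc L r)))

      i : Fin (n C k)
      i = index {n} {k} d

      ∣d∩A∣ : ∣ proj₁ d ∩ A ∣ ≡ suc L
      ∣d∩A∣ = trans (meets disj (sub K⊆A ∣K∣ (dis (λ y∈O → x∈∁p⇒x∉p (O⊆ y∈O)) []))) (+-identityʳ (suc L))

    f-nonConstant : n₀ ≤ n → NonConstant f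
    f-nonConstant n≥n₀ = x , y , λ fx≡fy → contradiction
      (trans (sym (dec-true (good? x) (proj₂ (exists-good n≥n₀))))
             (trans fx≡fy (dec-false (good? y) (all-false-bad n≥n₀)))) (λ ())
      where
      x = proj₁ (exists-good n≥n₀)
      y = replicate (n C k) false

  main : Σ[ bound ∈ ℕ ] (0 < bound ×
    (Σ[ g ∈ (∀ n → k ≤ n → BooleanFunction (n C k)) ]
      (∀ n (k≤n : k ≤ n) →
        NonConstant (g n k≤n) × IsHypergraphProperty n k (g n k≤n) × sensitivity (g n k≤n) ≤ bound * n ^ q)))
  main = bound , ≤-trans (m^n>0 2 m) (m≤m+n (2 ^ m) (∑C k n₀)) , (λ n _ → g n (n₀ ≤? n)) ,
    λ n → proof n (n₀ ≤? n)
    where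
    bound : ℕ
    -- The first summand serves `n` from `n₀` on; the second covers smaller `n` through the trivial
    -- bound by the number of variables.
    bound = 2 ^ m + ∑C k n₀

    g : ∀ n → Dec (n₀ ≤ n) → BooleanFunction (n C k)
    g n (yes _) = f {n}
    g n (no  _) = complete {n} {k}

    proof : ∀ n (large? : Dec (n₀ ≤ n)) → k ≤ n →
      NonConstant (g n large?) × IsHypergraphProperty n k (g n large?) ×
      sensitivity (g n large?) ≤ bound * n ^ q
    proof n (yes n≥n₀) _   = f-nonConstant n≥n₀ , f-property ,
      ≤-trans (f-sensitivity n≥n₀) (*-monoˡ-≤ (n ^ q) (m≤m+n (2 ^ m) (∑C k n₀)))
    proof n (no n≱n₀)  k≤n = complete-nonConstant {n} {k} k≤n , complete-property {n} {k} , (begin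
      sensitivity (complete {n} {k})   ≤⟨ sensitivity-≤ (complete {n} {k}) (λ x → count≤n
                                            (λ i → ¬? (complete {n} {k} x Bool.≟ complete {n} {k} (flipBit x i)))
                                            (allFin (n C k))) ⟩
      n C k                            ≤⟨ nCk≤∑C k (≰⇒> n≱n₀) ⟩
      ∑C k n₀                          ≤⟨ m≤n+m (∑C k n₀) (2 ^ m) ⟩
      bound                            ≤⟨ m≤m*n bound (n ^ q)
                                            {{>-nonZero (m^n>0 n {{>-nonZero (≤-trans (s≤s z≤n) k≤n)}} q)}} ⟩
      bound * n ^ q                    ∎)
      where open ≤-Reasoning

-- Parameters for each residue of `k` modulo 3

record Parameters (k : ℕ) : Set where
  field
    c r w p o : ℕ
    c≤1+r     : c ≤ suc r
    w+p≡      : w + p ≡ suc (c + r)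
    p+o≡r     : p + o ≡ r
    w-even    : odd w ≡ false
    k≡        : suc (c + r) + suc r ≡ k
    ⌈k/3⌉≡    : suc r ≡ ⌈ k /3⌉

-- Induction in steps of 3 from k = 3, 4, 5: raising `c` and `r` by one raises L by two and q by
-- one. Then `w` grows by two and stays even, `p` keeps the parity of L, and `o` absorbs the growth
-- of `r`.
parameters : ∀ j → Parameters (3 + j)
parameters 0 = record { c = 1 ; r = 0 ; w = 2 ; p = 0 ; o = 0 ; c≤1+r = s≤s z≤n
  ; w+p≡ = refl ; p+o≡r = refl ; w-even = refl ; k≡ = refl ; ⌈k/3⌉≡ = refl }
parameters 1 = record { c = 0 ; r = 1 ; w = 2 ; p = 0 ; o = 1 ; c≤1+r = z≤n
  ; w+p≡ = refl ; p+o≡r = refl ; w-even = refl ; k≡ = refl ; ⌈k/3⌉≡ = refl }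
parameters 2 = record { c = 1 ; r = 1 ; w = 2 ; p = 1 ; o = 0 ; c≤1+r = s≤s z≤n
  ; w+p≡ = refl ; p+o≡r = refl ; w-even = refl ; k≡ = refl ; ⌈k/3⌉≡ = refl }
parameters (suc (suc (suc j))) = record
  { c = suc c ; r = suc r ; w = 2 + w ; p = p ; o = suc o
  ; c≤1+r  = s≤s c≤1+r
  ; w+p≡   = cong suc (trans (cong suc w+p≡) (cong suc (sym (+-suc c r))))
  ; p+o≡r  = trans (+-suc p o) (cong suc p+o≡r)
  ; w-even = trans (Bool.not-involutive (odd w)) w-even
  ; k≡     = trans (cong₂ (λ s t → 2 + (s + t)) (+-suc c r) refl)
               (trans (cong (2 +_) (+-suc (suc (c + r)) (suc r))) (cong (3 +_) k≡))
  ; ⌈k/3⌉≡ = trans (cong suc ⌈k/3⌉≡) (sym (+-distrib-/-∣ˡ {3} (3 + j + 2) {3} ∣-refl))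
  }
  where open Parameters (parameters j)

theorem1 : ∀ (k : ℕ) → 3 ≤ k →
    Σ[ c ∈ ℕ ] (0 < c ×
    (Σ[ f ∈ (∀ n → k ≤ n → BooleanFunction (n C k)) ]
    (∀ n (k≤n : k ≤ n) →
    NonConstant (f n k≤n) ×
    IsHypergraphProperty n k (f n k≤n) ×
    sensitivity (f n k≤n) ≤ c * n ^ ⌈ k /3⌉)))
theorem1 (suc (suc (suc j))) (s≤s (s≤s (s≤s _))) =
  subst₂ (λ k q → Σ[ c ∈ ℕ ] (0 < c ×
      (Σ[ f ∈ (∀ n → k ≤ n → BooleanFunction (n C k)) ]
        (∀ n (k≤n : k ≤ n) →
          NonConstant (f n k≤n) × IsHypergraphProperty n k (f n k≤n) × sensitivity (f n k≤n) ≤ c * n ^ q))))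
    k≡ ⌈k/3⌉≡ (Patterns.main c r c≤1+r w p o w+p≡ p+o≡r w-even)
  where open Parameters (parameters j)
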